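{- Let $H(x,u)=\sum_{n\ge0}\sum_{k\ge0} h_{n,k}x^nu^k$, where $h_{n,k}$ is the number of permutations $\sigma\in\mathcal{S}^2_n(321)$ with $\operatorname{lif}(\sigma)=k$ (so $h_{0,0}=1$ counts the empty forest). Then $H$ satisfies $$H(x,u)=1+\frac{xu}{1-u}\Bigg(\frac{u^2(1-3u+2u^2-u^3)}{(1-u)^2}H(x,u)+\frac{1-3u+3u^2-u^3+u^4}{(1-u)^2}H(x,1)+\frac{2-2u-u^2}{1-u}\frac{\partial H}{\partial u}(x,1)+\frac12\frac{\partial^2H}{\partial u^2}(x,1)\Bigg).$$
   Context: $\mathcal{S}^2_n(321)$ denotes the set of permutations $\pi\in\mathcal{S}_{3n}$ that avoid $321$ (no indices $a<b<c$ with $\pi_a>\pi_b>\pi_c$) and satisfy $\pi_{3i+1}<\pi_{3i+2}$ and $\pi_{3i+1}<\pi_{3i+3}$ for all $0\le i<n$ (permutations of $321$-avoiding binary shrub forests with $n$ shrubs). For a permutation $\pi$ of length $N$: if $\pi$ is the identity $12\cdots N$ then $\operatorname{lif}(\pi)=N$; otherwise let $\pi(i)$ be the rightmost entry of $\pi$ that is not a left-to-right maximum (equivalently, the smaller entry of the rightmost inversion), and set $\operatorname{lif}(\pi)=N-\pi(i)$, the number of entries larger than it. -}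

module Defs where

open import Data.Bool using (Bool; true; false; _∧_; _∨_; not; if_then_else_)
open import Data.Nat as ℕ using (ℕ; zero; suc; _∸_; _≡ᵇ_; _<ᵇ_)
open import Data.List using (List; []; _∷_; map; concatMap; length; filter; foldr)
open import Data.Maybe using (Maybe; just; nothing)
open import Data.Integer using (ℤ; +_; -[1+_])
open import Data.Rational using (ℚ; 0ℚ; 1ℚ; ½; _+_; _*_; _/_)
open import Relation.Nullary.Decidable using (Dec; yes; no)
open import Relation.Binary.PropositionalEquality using (_≡_; refl)
open import Data.Bool.Properties using () renaming (_≟_ to _≟ᵇ_)

-- Permutations are represented as lists (one-line notation π₁ π₂ … π_N)

oneTo : ℕ → List ℕ
oneTo m = go m []
  where
  go : ℕ → List ℕ → List ℕ
  go zero acc    = acc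
  go (suc j) acc = go j (suc j ∷ acc)

words : ℕ → ℕ → List (List ℕ)
words zero    m = [] ∷ []
words (suc l) m = concatMap (λ a → map (a ∷_) (words l m)) (oneTo m)

elem : ℕ → List ℕ → Bool
elem a []       = false
elem a (b ∷ bs) = (a ≡ᵇ b) ∨ elem a bs

distinct : List ℕ → Bool
distinct []       = true
distinct (a ∷ as) = not (elem a as) ∧ distinct as

allPerms : ℕ → List (List ℕ)
allPerms N = filter (λ w → distinct w ≟ᵇ true) (words N N)

anyBelow : ℕ → List ℕ → Bool
anyBelow b []       = false
anyBelow b (y ∷ ys) = (y <ᵇ b) ∨ anyBelow b ys

has21Below : ℕ → List ℕ → Bool
has21Below a []       = false
has21Below a (b ∷ bs) = ((b <ᵇ a) ∧ anyBelow b bs) ∨ has21Below a bs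

avoids321 : List ℕ → Bool
avoids321 []       = true
avoids321 (a ∷ as) = not (has21Below a as) ∧ avoids321 as

shrubCond : List ℕ → Bool
shrubCond []                 = true
shrubCond (a ∷ b ∷ c ∷ rest) = (a <ᵇ b) ∧ (a <ᵇ c) ∧ shrubCond rest
shrubCond _                  = false

listEq : List ℕ → List ℕ → Bool
listEq []       []       = true
listEq (a ∷ as) (b ∷ bs) = (a ≡ᵇ b) ∧ listEq as bs
listEq _        _        = false

-- rightmost entry that is not a left-to-right maximum
-- (an entry is not a LR maximum iff it is smaller than the maximum of the
--  entries before it; entries of a permutation are distinct)
lastNonLRMax : List ℕ → Maybe ℕ
lastNonLRMax = go 0 nothing
  where
  go : ℕ → Maybe ℕ → List ℕ → Maybe ℕ
  go mx r []       = r
  go mx r (a ∷ as) = if a <ᵇ mx then go mx (just a) as else go a r as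

lif : ℕ → List ℕ → ℕ
lif N π with listEq π (oneTo N)
... | true  = N
... | false with lastNonLRMax π
...   | just v  = N ∸ v
...   | nothing = N   -- unreachable for non-identity permutations

S2-321 : ℕ → List (List ℕ)
S2-321 n = filter (λ π → (avoids321 π ∧ shrubCond π) ≟ᵇ true) (allPerms (3 ℕ.* n))

h : ℕ → ℕ → ℕ
h n k = length (filter (λ σ → (lif (3 ℕ.* n) σ ≡ᵇ k) ≟ᵇ true) (S2-321 n))

-- Formal power series in x, u with rational coefficients:
-- a series F is given by its coefficients F n k = [x^n u^k] F.

Series : Set
Series = ℕ → ℕ → ℚ

fromℕℚ : ℕ → ℚ
fromℕℚ m = + m / 1

sumTo : ℕ → (ℕ → ℚ) → ℚ
sumTo zero    f = f 0
sumTo (suc n) f = sumTo n f + f (suc n)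

_⊕_ : Series → Series → Series
(F ⊕ G) n k = F n k + G n k

_⊛_ : Series → Series → Series
(F ⊛ G) n k = sumTo n (λ i → sumTo k (λ j → F i j * G (n ∸ i) (k ∸ j)))

infixl 6 _⊕_
infixl 7 _⊛_

scal : ℚ → Series → Series
scal c F n k = c * F n k

nth : ℕ → List ℚ → ℚ
nth _       []       = 0ℚ
nth zero    (c ∷ cs) = c
nth (suc k) (c ∷ cs) = nth k cs

polyU : List ℚ → Series
polyU cs zero    k = nth k cs
polyU cs (suc n) k = 0ℚ

one : Series
one = polyU (1ℚ ∷ [])

U : Series
U = polyU (0ℚ ∷ 1ℚ ∷ [])

X : Series
X (suc zero) zero = 1ℚ
X _          _    = 0ℚ

inv1-u : Series
inv1-u zero    k = 1ℚ
inv1-u (suc n) k = 0ℚ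

-- The generating function and its specializations at u = 1.
-- Since lif σ ≤ 3n for σ ∈ S_{3n}, h n k = 0 for k > 3n, so the sums
-- over k are the finite sums k = 0..3n.

H : Series
H n k = fromℕℚ (h n k)

H₁ : Series
H₁ n zero    = sumTo (3 ℕ.* n) (λ k → fromℕℚ (h n k))
H₁ n (suc _) = 0ℚ

Hu₁ : Series
Hu₁ n zero    = sumTo (3 ℕ.* n) (λ k → fromℕℚ (k ℕ.* h n k))
Hu₁ n (suc _) = 0ℚ

Huu₁ : Series
Huu₁ n zero    = sumTo (3 ℕ.* n) (λ k → fromℕℚ (k ℕ.* (k ∸ 1) ℕ.* h n k))
Huu₁ n (suc _) = 0ℚ

q : ℤ → ℚ
q z = z / 1

Apoly : Series
Apoly = polyU (0ℚ ∷ 0ℚ ∷ q (+ 1) ∷ q (-[1+ 2 ]) ∷ q (+ 2) ∷ q (-[1+ 0 ]) ∷ [])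

Bpoly : Series
Bpoly = polyU (q (+ 1) ∷ q (-[1+ 2 ]) ∷ q (+ 3) ∷ q (-[1+ 0 ]) ∷ q (+ 1) ∷ [])

Cpoly : Series
Cpoly = polyU (q (+ 2) ∷ q (-[1+ 1 ]) ∷ q (-[1+ 0 ]) ∷ [])

RHS : Series
RHS = one ⊕ X ⊛ U ⊛ inv1-u ⊛
        ( Apoly ⊛ inv1-u ⊛ inv1-u ⊛ H
        ⊕ Bpoly ⊛ inv1-u ⊛ inv1-u ⊛ H₁
        ⊕ Cpoly ⊛ inv1-u ⊛ Hu₁
        ⊕ scal ½ Huu₁ )

{-# OPTIONS --safe #-}
module Submission where

-- A permutation of N + 1 letters arises uniquely from one of N letters by appending a last entry and raising
-- the old entries that are not below it.  If m old entries end up above the new one, the result avoids 321 iff the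
-- old permutation does and m ≤ lif, and the new lif is m, or lif + 1 when m = 0.  A shrub is three such steps
-- with parameters m₁, m₂, m₃ subject to m₂ ≤ m₁ and m₃ ≤ m₁ + 1, so the number childCount ℓ k of its outcomes of
-- lif k depends only on the initial lif ℓ.  Removing the outer factor u / (1 - u), the functional equation says that
-- childCount ℓ (k + 1) - childCount ℓ k is the coefficient of u^k in
--   u^ℓ A / (1 - u)² + B / (1 - u)² + ℓ C / (1 - u) + ℓ (ℓ - 1) / 2,
-- where A, B, C are the three numerators; this follows by induction on ℓ, as the differences in ℓ are explicit.

open import Defs
open import Data.Nat using (ℕ)
open import Data.Bool using (Bool; true; false; _∧_; _∨_; not; if_then_else_)
open import Data.List using (List; []; _∷_; map)
open import Data.List.Properties using (map-cong)
open import Data.List.Relation.Unary.All as All using (All; []; _∷_)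
open import Data.Nat as ℕ using (zero; suc; _∸_; _≤_; _<_; z≤n; s≤s; _<ᵇ_; _≡ᵇ_; _⊓_)
open import Data.Nat.ListAction using (sum)
import Data.Nat.Properties as ℕ
open import Data.Product using (_×_; _,_; proj₁; proj₂; ∃)
open import Function using (_∘_; id)
open import Relation.Binary.PropositionalEquality hiding ([_])

-- Combinatorics of appending letters.

module Insertion where

  open import Data.Bool.Properties using (∨-assoc; ∧-assoc; ∨-identityʳ; ∧-zeroʳ; T-≡) renaming (_≟_ to _≟ᵇ_)
  open import Data.List using ([_]; _++_; _∷ʳ_; concatMap; length; filter; applyUpTo)
  open import Data.List.Membership.Propositional using (_∈_; lose; find)
  open import Data.List.Membership.Propositional.Properties
  open import Data.List.Membership.Propositional.Properties.WithK using (unique∧set⇒bag)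
  open import Data.List.Properties hiding (sum-++; map-cong)
  open import Data.List.Relation.Binary.BagAndSetEquality using (∼bag⇒↭)
  open import Data.List.Relation.Binary.Permutation.Propositional using (_↭_)
  import Data.List.Relation.Binary.Permutation.Propositional.Properties as ↭
  import Data.List.Relation.Unary.All.Properties as All
  open import Data.List.Relation.Unary.AllPairs as AllPairs using ([]; _∷_)
  import Data.List.Relation.Unary.AllPairs.Properties as AllPairs
  open import Data.List.Relation.Unary.Any using (here; there)
  open import Data.List.Relation.Unary.Unique.Propositional using (Unique)
  import Data.List.Relation.Unary.Unique.Propositional.Properties as Unique
  open import Data.List.Reverse using (Reverse; []; _∶_∶ʳ_; reverseView)
  open import Data.Maybe using (Maybe; just; nothing; fromMaybe)
  open import Data.Nat using (_+_; _*_)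
  open import Data.Nat.ListAction.Properties using (sum-↭; sum-++)
  open import Data.Nat.Properties
  open import Function.Bundles using (mk⇔; Equivalence)
  open import Relation.Nullary using (yes; no; contradiction)

  -- The helpers go of oneTo and lastNonLRMax are local to Defs and have no name here; each underscore is solved to
  -- one of them by the first lemma of its block, where with-abstraction makes all arguments distinct variables.
  mutual
    oneTo-suc : ∀ m → oneTo (suc m) ≡ applyUpTo suc m ++ suc m ∷ []
    oneTo-suc m with suc m | [ suc m ]
    ... | M | acc = oneTo-go M m acc

    oneTo-go : ∀ (M j : ℕ) (acc : List ℕ) → _ ≡ applyUpTo suc j ++ acc
    oneTo-go M zero    acc = refl
    oneTo-go M (suc j) acc = trans (oneTo-go M j (suc j ∷ acc))
      (trans (sym (++-assoc (applyUpTo suc j) _ acc)) (cong (_++ acc) (applyUpTo-∷ʳ suc j)))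

  oneTo-upTo : ∀ m → oneTo m ≡ applyUpTo suc m
  oneTo-upTo zero    = refl
  oneTo-upTo (suc m) = trans (oneTo-suc m) (applyUpTo-∷ʳ suc m)

  scanNonLRMax : ℕ → Maybe ℕ → List ℕ → Maybe ℕ
  scanNonLRMax mx r []       = r
  scanNonLRMax mx r (a ∷ as) = if a <ᵇ mx then scanNonLRMax mx (just a) as else scanNonLRMax a r as

  mutual
    lastNonLRMax-scanNonLRMax : ∀ w → lastNonLRMax w ≡ scanNonLRMax 0 nothing w
    lastNonLRMax-scanNonLRMax w with 0 | nothing {A = ℕ}
    ... | mx | r = lastNonLRMax-go mx r w

    lastNonLRMax-go : ∀ (mx : ℕ) (r : Maybe ℕ) (w : List ℕ) → _ ≡ scanNonLRMax mx r w
    lastNonLRMax-go mx r []       = refl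
    lastNonLRMax-go mx r (a ∷ as) with a <ᵇ mx
    ... | true  = lastNonLRMax-go mx (just a) as
    ... | false = lastNonLRMax-go a r as

  -- Boolean comparison of naturals.

  <ᵇ-true : ∀ {m n} → m < n → (m <ᵇ n) ≡ true
  <ᵇ-true m<n = Equivalence.to T-≡ (<⇒<ᵇ m<n)

  <ᵇ-false : ∀ {m n} → n ≤ m → (m <ᵇ n) ≡ false
  <ᵇ-false z≤n       = refl
  <ᵇ-false (s≤s n≤m) = <ᵇ-false n≤m

  <ᵇ-true⁻ : ∀ m n → (m <ᵇ n) ≡ true → m < n
  <ᵇ-true⁻ m n eq = <ᵇ⇒< m n (Equivalence.from T-≡ eq)

  <ᵇ-false⁻ : ∀ m n → (m <ᵇ n) ≡ false → n ≤ m
  <ᵇ-false⁻ m       zero    _  = z≤n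
  <ᵇ-false⁻ (suc m) (suc n) eq = s≤s (<ᵇ-false⁻ m n eq)

  ≡ᵇ-true⁻ : ∀ m n → (m ≡ᵇ n) ≡ true → m ≡ n
  ≡ᵇ-true⁻ m n eq = ≡ᵇ⇒≡ m n (Equivalence.from T-≡ eq)

  ≡ᵇ-false⁻ : ∀ m n → (m ≡ᵇ n) ≡ false → m ≢ n
  ≡ᵇ-false⁻ zero    (suc n) _  ()
  ≡ᵇ-false⁻ (suc m) zero    _  ()
  ≡ᵇ-false⁻ (suc m) (suc n) eq m≡n = ≡ᵇ-false⁻ m n eq (suc-injective m≡n)

  ≡ᵇ-false : ∀ m n → m ≢ n → (m ≡ᵇ n) ≡ false
  ≡ᵇ-false m n m≢n with m ≡ᵇ n in eq
  ... | true  = contradiction (≡ᵇ-true⁻ m n eq) m≢n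
  ... | false = refl

  ∧-true⁻ : ∀ a {b} → (a ∧ b) ≡ true → a ≡ true × b ≡ true
  ∧-true⁻ true eq = refl , eq

  -- Permutations

  elem-false⁻ : ∀ a bs → elem a bs ≡ false → All (a ≢_) bs
  elem-false⁻ a []       _  = []
  elem-false⁻ a (b ∷ bs) eq with a ≡ᵇ b in e
  ... | false = ≡ᵇ-false⁻ a b e ∷ elem-false⁻ a bs eq

  elem-false : ∀ a bs → All (a ≢_) bs → elem a bs ≡ false
  elem-false a []       []         = refl
  elem-false a (b ∷ bs) (a≢b ∷ ps) rewrite ≡ᵇ-false a b a≢b = elem-false a bs ps

  distinct⇒Unique : ∀ w → distinct w ≡ true → Unique w
  distinct⇒Unique []       _  = []
  distinct⇒Unique (a ∷ as) eq with elem a as in e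
  ... | false = elem-false⁻ a as e ∷ distinct⇒Unique as eq

  Unique⇒distinct : ∀ {w} → Unique w → distinct w ≡ true
  Unique⇒distinct []                     = refl
  Unique⇒distinct {a ∷ as} (a∉as ∷ u) rewrite elem-false a as a∉as = Unique⇒distinct u

  InRange : ℕ → ℕ → Set
  InRange N x = 1 ≤ x × x ≤ N

  ∈-oneTo⁺ : ∀ {N x} → InRange N x → x ∈ oneTo N
  ∈-oneTo⁺ {N} {suc x} (_ , x<N) rewrite oneTo-upTo N = ∈-applyUpTo⁺ suc x<N

  ∈-oneTo⁻ : ∀ {N x} → x ∈ oneTo N → InRange N x
  ∈-oneTo⁻ {N} x∈ rewrite oneTo-upTo N with ∈-applyUpTo⁻ suc x∈
  ... | _ , i<N , refl = s≤s z≤n , i<N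

  oneTo-unique : ∀ N → Unique (oneTo N)
  oneTo-unique N rewrite oneTo-upTo N =
    Unique.applyUpTo⁺₁ suc N (λ i<j _ e → <⇒≢ i<j (suc-injective e))

  ∈-words⁺ : ∀ {m w} → All (InRange m) w → w ∈ words (length w) m
  ∈-words⁺ []                = here refl
  ∈-words⁺ {m} {x ∷ w} (p ∷ ps) =
    ∈-concatMap⁺ _ (lose (∈-oneTo⁺ p) (∈-map⁺ (x ∷_) (∈-words⁺ ps)))

  ∈-words⁻ : ∀ l {m w} → w ∈ words l m → length w ≡ l × All (InRange m) w
  ∈-words⁻ zero    (here refl) = refl , []
  ∈-words⁻ (suc l) {m} w∈ with find (∈-concatMap⁻ (λ a → map (a ∷_) (words l m)) {xs = oneTo m} w∈)
  ... | a , a∈ , w∈′ with ∈-map⁻ (a ∷_) w∈′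
  ... | w′ , w′∈ , refl with ∈-words⁻ l w′∈
  ... | len , all = cong suc len , ∈-oneTo⁻ a∈ ∷ all

  concatMap-unique : ∀ {A B : Set} (f : A → List B) {xs} → Unique xs →
    (∀ {x} → x ∈ xs → Unique (f x)) →
    (∀ {x y z} → z ∈ f x → z ∈ f y → x ≡ y) → Unique (concatMap f xs)
  concatMap-unique f {xs} u uf inj = Unique.concat⁺
    (All.map⁺ (All.tabulate uf))
    (AllPairs.map⁺ (AllPairs.map (λ x≢y {_} (z∈x , z∈y) → x≢y (inj z∈x z∈y)) u))

  words-unique : ∀ l m → Unique (words l m)
  words-unique zero    m = [] ∷ []
  words-unique (suc l) m = concatMap-unique _ (oneTo-unique m)
    (λ _ → Unique.map⁺ ∷-injectiveʳ (words-unique l m))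
    (λ z∈x z∈y → disj (∈-map⁻ _ z∈x) (∈-map⁻ _ z∈y))
    where
    disj : ∀ {x y z} {ws : List (List ℕ)} → ∃ (λ w → w ∈ ws × z ≡ x ∷ w) →
           ∃ (λ w → w ∈ ws × z ≡ y ∷ w) → x ≡ y
    disj (_ , _ , refl) (_ , _ , refl) = refl

  allPerms-unique : ∀ N → Unique (allPerms N)
  allPerms-unique N = Unique.filter⁺ (λ w → distinct w ≟ᵇ true) (words-unique N N)

  record IsPerm (N : ℕ) (w : List ℕ) : Set where
    constructor isPerm
    field
      len    : length w ≡ N
      range  : All (InRange N) w
      unique : Unique w

  ∈-allPerms⁺ : ∀ {N w} → IsPerm N w → w ∈ allPerms N
  ∈-allPerms⁺ (isPerm refl r u) =
    ∈-filter⁺ (λ w → distinct w ≟ᵇ true) (∈-words⁺ r) (Unique⇒distinct u)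

  ∈-allPerms⁻ : ∀ {N w} → w ∈ allPerms N → IsPerm N w
  ∈-allPerms⁻ {N} {w} w∈ with ∈-filter⁻ (λ w → distinct w ≟ᵇ true) {xs = words N N} w∈
  ... | w∈words , d with ∈-words⁻ N w∈words
  ... | l , r = isPerm l r (distinct⇒Unique w d)

  -- Insertion of a last entry

  bump : ℕ → ℕ → ℕ
  bump v x = if v <ᵇ x then suc x else x

  unbump : ℕ → ℕ → ℕ
  unbump v x = if v <ᵇ x then x ∸ 1 else x

  -- Here `v` counts the old entries below the new last one, so for `N` old letters it runs over 0,
  -- ..., `N` and `N ∸ v` entries lie above.
  app : ℕ → List ℕ → List ℕ
  app v π = map (bump v) π ∷ʳ suc v

  bump-< : ∀ v x y → (bump v x <ᵇ bump v y) ≡ (x <ᵇ y)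
  bump-< v x y with v <ᵇ x in ex | v <ᵇ y in ey
  ... | true  | true  = refl
  ... | false | false = refl
  ... | true  | false = trans (<ᵇ-false (≤-trans y≤v (≤-trans v≤x (n≤1+n x)))) (sym (<ᵇ-false (≤-trans y≤v v≤x)))
    where
    y≤v = <ᵇ-false⁻ v y ey
    v≤x = <⇒≤ (<ᵇ-true⁻ v x ex)
  ... | false | true  = trans (<ᵇ-true (s≤s (<⇒≤ x<y))) (sym (<ᵇ-true x<y))
    where
    x<y = ≤-<-trans (<ᵇ-false⁻ v x ex) (<ᵇ-true⁻ v y ey)

  unbump-bump : ∀ v x → unbump v (bump v x) ≡ x
  unbump-bump v x with v <ᵇ x in ex
  ... | true  rewrite <ᵇ-true {v} {suc x} (≤-trans (<ᵇ-true⁻ v x ex) (n≤1+n x)) = refl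
  ... | false rewrite ex = refl

  bump-injective : ∀ v {x y} → bump v x ≡ bump v y → x ≡ y
  bump-injective v {x} {y} eq =
    trans (sym (unbump-bump v x)) (trans (cong (unbump v) eq) (unbump-bump v y))

  -- `suc v` is the one value that `bump v` skips to make room for the new letter.
  bump-unbump : ∀ v {x} → suc v ≢ x → bump v (unbump v x) ≡ x
  bump-unbump v {x} sv≢x with v <ᵇ x in ex
  bump-unbump v {suc x} sv≢x | true rewrite <ᵇ-true {v} {x} (≤∧≢⇒< (≤-pred (<ᵇ-true⁻ v (suc x) ex)) (sv≢x ∘ cong suc)) = refl
  bump-unbump v {x} sv≢x | false rewrite ex = refl

  bump-range : ∀ v {N x} → InRange N x → InRange (suc N) (bump v x)
  bump-range v {N} {x} (1≤x , x≤N) with v <ᵇ x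
  ... | true  = s≤s z≤n , s≤s x≤N
  ... | false = 1≤x , m≤n⇒m≤1+n x≤N

  unbump-range : ∀ {v N x} → v ≤ N → suc v ≢ x → InRange (suc N) x → InRange N (unbump v x)
  unbump-range {v} {N} {x} v≤N sv≢x (1≤x , x≤sN) with v <ᵇ x in ex
  unbump-range {v} {N} {suc x} v≤N sv≢x (1≤x , x≤sN) | true =
    ≤-<-trans z≤n (≤∧≢⇒< (≤-pred (<ᵇ-true⁻ v (suc x) ex)) (sv≢x ∘ cong suc)) , ≤-pred x≤sN
  ... | false = 1≤x , ≤-trans (<ᵇ-false⁻ v x ex) v≤N

  bump-≢ : ∀ v x → bump v x ≢ suc v
  bump-≢ v x eq with v <ᵇ x in ex
  bump-≢ v x refl | true = <-irrefl refl (<ᵇ-true⁻ v v ex)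
  bump-≢ v x refl | false with <ᵇ-false⁻ v (suc v) ex
  ... | p = <-irrefl refl p

  unique-∷ʳ : ∀ {xs : List ℕ} {x} → Unique xs → All (x ≢_) xs → Unique (xs ∷ʳ x)
  unique-∷ʳ u x∉ = Unique.++⁺ u ([] ∷ []) λ { (z∈xs , here refl) → All.lookup x∉ z∈xs refl }

  app-isPerm : ∀ {v N π} → v ≤ N → IsPerm N π → IsPerm (suc N) (app v π)
  app-isPerm {v} {N} {π} v≤N (isPerm l r u) = isPerm
    (trans (length-++ (map (bump v) π)) (trans (+-comm _ 1) (cong suc (trans (length-map (bump v) π) l))))
    (All.++⁺ (All.map⁺ (All.map (bump-range v) r)) ((s≤s z≤n , s≤s v≤N) ∷ []))
    (unique-∷ʳ (Unique.map⁺ (bump-injective v) u) (All.map⁺ (All.universal (λ x → ≢-sym (bump-≢ v x)) π)))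

  app-injective : ∀ {v v′ π π′} → app v π ≡ app v′ π′ → v ≡ v′ × π ≡ π′
  app-injective {v} {v′} {π} {π′} eq with ∷ʳ-injective (map (bump v) π) (map (bump v′) π′) eq
  ... | eq′ , refl = refl , map-injective (bump-injective v) eq′

  unique-∷ʳ⁻ : ∀ (xs : List ℕ) {x} → Unique (xs ∷ʳ x) → Unique xs × All (x ≢_) xs
  unique-∷ʳ⁻ []       _        = [] , []
  unique-∷ʳ⁻ (y ∷ xs) (p ∷ u) with unique-∷ʳ⁻ xs u | All.++⁻ xs p
  ... | u′ , q | p′ , y≢x ∷ [] = p′ ∷ u′ , ≢-sym y≢x ∷ q

  -- The last entry determines `v`, and closing the gap it leaves among the other entries recovers
  -- `π`.
  app-surjective : ∀ {N w} → IsPerm (suc N) w → ∃ λ v → ∃ λ π → v ≤ N × IsPerm N π × w ≡ app v π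
  app-surjective {N} {w} p with reverseView w
  app-surjective {N} {_} (isPerm l r u) | xs ∶ _ ∶ʳ x with All.++⁻ xs r | unique-∷ʳ⁻ xs u
  app-surjective {N} {_} (isPerm l r u) | xs ∶ _ ∶ʳ zero | _ , (() , _) ∷ [] | _
  app-surjective {N} {_} (isPerm l r u) | xs ∶ _ ∶ʳ suc v | rs , (_ , s≤s v≤N) ∷ [] | u′ , sv∉ =
    v , map (unbump v) xs , v≤N ,
    isPerm
      (trans (length-map (unbump v) xs) (suc-injective (trans (+-comm 1 _) (trans (sym (length-++ xs)) l))))
      (All.map⁺ (All.zipWith (λ (sv≢x , rx) → unbump-range v≤N sv≢x rx) (sv∉ , rs)))
      -- Bumping the lowered entries gives back `xs`, which has no repetitions, so the lowered
      -- entries have none either.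
      (Unique.map⁻ {f = bump v} (subst Unique (sym xs≡) u′)) ,
    cong (_∷ʳ suc v) (sym xs≡)
    where
    xs≡ : map (bump v) (map (unbump v) xs) ≡ xs
    xs≡ = trans (sym (map-∘ xs)) (map-id-local (All.map (bump-unbump v) sv∉))

  children : ℕ → List ℕ → List (List ℕ)
  children N π = map (λ v → app v π) (applyUpTo id (suc N))

  ∈-children⁻ : ∀ N {π w} → w ∈ children N π → ∃ λ v → v ≤ N × w ≡ app v π
  ∈-children⁻ N w∈ with ∈-map⁻ _ w∈
  ... | v , v∈ , eq = v , ≤-pred (∈-upTo⁻ v∈) , eq

  -- Two duplicate-free lists with the same members are rearrangements of each other. The orders of
  -- enumeration differ, which does not matter for sums.
  allPerms-children : ∀ N → allPerms (suc N) ↭ concatMap (children N) (allPerms N)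
  allPerms-children N = ∼bag⇒↭ (unique∧set⇒bag (allPerms-unique (suc N)) u (mk⇔ to from))
    where
    u : Unique (concatMap (children N) (allPerms N))
    u = concatMap-unique (children N) (allPerms-unique N)
      (λ _ → Unique.map⁺ (λ eq → proj₁ (app-injective eq)) (Unique.upTo⁺ (suc N)))
      (λ z∈x z∈y → same (∈-children⁻ N z∈x) (∈-children⁻ N z∈y))
      where
      same : ∀ {π π′ w} → ∃ (λ v → v ≤ N × w ≡ app v π) → ∃ (λ v → v ≤ N × w ≡ app v π′) → π ≡ π′
      same {π} (v , _ , eq) (v′ , _ , eq′) = proj₂ (app-injective {v} {v′} {π} (trans (sym eq) eq′))
    to : ∀ {w} → w ∈ allPerms (suc N) → w ∈ concatMap (children N) (allPerms N)
    to w∈ with app-surjective (∈-allPerms⁻ w∈)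
    ... | v , π , v≤N , p , refl =
      ∈-concatMap⁺ (children N) (lose (∈-allPerms⁺ p) (∈-map⁺ (λ v → app v π) (∈-upTo⁺ (s≤s v≤N))))
    from : ∀ {w} → w ∈ concatMap (children N) (allPerms N) → w ∈ allPerms (suc N)
    from w∈ with find (∈-concatMap⁻ (children N) {xs = allPerms N} w∈)
    ... | π , π∈ , w∈′ with ∈-children⁻ N w∈′
    ... | v , v≤N , refl = ∈-allPerms⁺ (app-isPerm v≤N (∈-allPerms⁻ π∈))

  -- Finite sums over permutations.

  guard : Bool → ℕ → ℕ
  guard b x = if b then x else 0

  Σ< : ℕ → (ℕ → ℕ) → ℕ
  Σ< zero    f = 0
  Σ< (suc n) f = f 0 + Σ< n (f ∘ suc)

  sum-map-concatMap : ∀ {A B : Set} (f : B → ℕ) (g : A → List B) xs →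
    sum (map f (concatMap g xs)) ≡ sum (map (λ x → sum (map f (g x))) xs)
  sum-map-concatMap f g []       = refl
  sum-map-concatMap f g (x ∷ xs) = trans (cong sum (map-++ f (g x) (concatMap g xs)))
    (trans (sum-++ (map f (g x)) _) (cong (sum (map f (g x)) +_) (sum-map-concatMap f g xs)))

  -- Passes from the number of entries below the new letter to the number `m` above it, the
  -- parameter in which avoidance and lif are simple.
  sum-upTo-reverse : ∀ n f → sum (map f (applyUpTo id (suc n))) ≡ Σ< (suc n) (λ m → f (n ∸ m))
  sum-upTo-reverse zero    f = refl
  sum-upTo-reverse (suc n) f = begin
    sum (map f (applyUpTo id (suc (suc n))))          ≡⟨ cong (sum ∘ map f) (sym (applyUpTo-∷ʳ id (suc n))) ⟩
    sum (map f (applyUpTo id (suc n) ∷ʳ suc n))       ≡⟨ cong sum (map-++ f (applyUpTo id (suc n)) _) ⟩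
    sum (map f (applyUpTo id (suc n)) ∷ʳ f (suc n))   ≡⟨ sum-++ (map f (applyUpTo id (suc n))) _ ⟩
    sum (map f (applyUpTo id (suc n))) + (f (suc n) + 0) ≡⟨ +-comm (sum (map f (applyUpTo id (suc n)))) _ ⟩
    f (suc n) + 0 + sum (map f (applyUpTo id (suc n))) ≡⟨ cong₂ _+_ (+-identityʳ (f (suc n))) (sum-upTo-reverse n f) ⟩
    f (suc n) + Σ< (suc n) (λ m → f (n ∸ m))          ∎
    where open ≡-Reasoning

  sum-allPerms : ∀ N (f : List ℕ → ℕ) →
    sum (map f (allPerms (suc N))) ≡ sum (map (λ π → Σ< (suc N) (λ m → f (app (N ∸ m) π))) (allPerms N))
  sum-allPerms N f = begin
    sum (map f (allPerms (suc N)))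
      ≡⟨ sum-↭ (↭.map⁺ f (allPerms-children N)) ⟩
    sum (map f (concatMap (children N) (allPerms N)))
      ≡⟨ sum-map-concatMap f (children N) (allPerms N) ⟩
    sum (map (λ π → sum (map f (children N π))) (allPerms N))
      ≡⟨ cong sum (map-cong (λ π → trans (cong sum (sym (map-∘ (applyUpTo id (suc N)))))
          (sum-upTo-reverse N (λ v → f (app v π)))) (allPerms N)) ⟩
    sum (map (λ π → Σ< (suc N) (λ m → f (app (N ∸ m) π))) (allPerms N)) ∎
    where open ≡-Reasoning

  -- Pattern avoidance and lif under insertion

  anyAbove : ℕ → List ℕ → Bool
  anyAbove v []       = false
  anyAbove v (x ∷ xs) = (v <ᵇ x) ∨ anyAbove v xs

  descentBelow : ℕ → ℕ → List ℕ → Bool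
  descentBelow v a []       = false
  descentBelow v a (b ∷ bs) = ((b <ᵇ a) ∧ (v <ᵇ b)) ∨ descentBelow v a bs

  -- Detects an inversion with both entries above `v`: exactly what an appended `v` would complete
  -- to a 321.
  inversionAbove : ℕ → List ℕ → Bool
  inversionAbove v []       = false
  inversionAbove v (a ∷ as) = descentBelow v a as ∨ inversionAbove v as

  anyBelow-∷ʳ : ∀ b ys v → anyBelow b (ys ∷ʳ v) ≡ anyBelow b ys ∨ (v <ᵇ b)
  anyBelow-∷ʳ b []       v = ∨-identityʳ _
  anyBelow-∷ʳ b (y ∷ ys) v = trans (cong ((y <ᵇ b) ∨_) (anyBelow-∷ʳ b ys v)) (sym (∨-assoc (y <ᵇ b) _ _))

  has21Below-∷ʳ : ∀ a xs v → has21Below a (xs ∷ʳ v) ≡ has21Below a xs ∨ descentBelow v a xs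
  has21Below-∷ʳ a []       v rewrite ∧-zeroʳ (v <ᵇ a) = refl
  has21Below-∷ʳ a (b ∷ bs) v rewrite anyBelow-∷ʳ b bs v | has21Below-∷ʳ a bs v =
    distribute (b <ᵇ a) (anyBelow b bs) (v <ᵇ b) (has21Below a bs) (descentBelow v a bs)
    where
    distribute : ∀ p q r s t → (p ∧ (q ∨ r)) ∨ (s ∨ t) ≡ ((p ∧ q) ∨ s) ∨ ((p ∧ r) ∨ t)
    distribute false q     r     s     t = refl
    distribute true  true  r     s     t = refl
    distribute true  false true  true  t = refl
    distribute true  false true  false t = refl
    distribute true  false false s     t = refl

  avoids321-∷ʳ : ∀ xs v → avoids321 (xs ∷ʳ v) ≡ avoids321 xs ∧ not (inversionAbove v xs)
  avoids321-∷ʳ []       v = refl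
  avoids321-∷ʳ (a ∷ as) v rewrite has21Below-∷ʳ a as v | avoids321-∷ʳ as v =
    distribute (has21Below a as) (descentBelow v a as) (avoids321 as) (inversionAbove v as)
    where
    distribute : ∀ p q r s → not (p ∨ q) ∧ (r ∧ not s) ≡ (not p ∧ r) ∧ not (q ∨ s)
    distribute true  q     r     s = refl
    distribute false true  true  s = refl
    distribute false true  false s = refl
    distribute false false r     s = refl

  descentBelow-∷ʳ : ∀ v a xs b → descentBelow v a (xs ∷ʳ b) ≡ descentBelow v a xs ∨ ((b <ᵇ a) ∧ (v <ᵇ b))
  descentBelow-∷ʳ v a []       b = ∨-identityʳ _
  descentBelow-∷ʳ v a (x ∷ xs) b = trans (cong (_ ∨_) (descentBelow-∷ʳ v a xs b)) (sym (∨-assoc ((x <ᵇ a) ∧ (v <ᵇ x)) _ _))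

  inversionAbove-∷ʳ : ∀ v xs b → inversionAbove v (xs ∷ʳ b) ≡ inversionAbove v xs ∨ ((v <ᵇ b) ∧ anyAbove b xs)
  inversionAbove-∷ʳ v []       b = sym (∧-zeroʳ (v <ᵇ b))
  inversionAbove-∷ʳ v (a ∷ as) b rewrite descentBelow-∷ʳ v a as b | inversionAbove-∷ʳ v as b =
    distribute (descentBelow v a as) (b <ᵇ a) (v <ᵇ b) (inversionAbove v as) (anyAbove b as)
    where
    distribute : ∀ p q r s t → (p ∨ (q ∧ r)) ∨ (s ∨ (r ∧ t)) ≡ (p ∨ s) ∨ (r ∧ (q ∨ t))
    distribute true  q     r     s     t = refl
    distribute false true  true  true  t = refl
    distribute false true  true  false t = refl
    distribute false true  false true  t = refl
    distribute false true  false false t = refl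
    distribute false false r     s     t = refl

  -- The paper's π(i), with the value 0 for the identity, so that lif N π ≡ N ∸ lowest π without a case distinction.
  lowest : List ℕ → ℕ
  lowest w = fromMaybe 0 (scanNonLRMax 0 nothing w)

  scanNonLRMax-∷ʳ : ∀ mx r xs b → scanNonLRMax mx r (xs ∷ʳ b) ≡
    (if (b <ᵇ mx) ∨ anyAbove b xs then just b else scanNonLRMax mx r xs)
  scanNonLRMax-∷ʳ mx r []       b with b <ᵇ mx
  ... | true  = refl
  ... | false = refl
  scanNonLRMax-∷ʳ mx r (x ∷ xs) b with x <ᵇ mx in ex
  ... | false rewrite scanNonLRMax-∷ʳ x r xs b with b <ᵇ mx in eb
  ...   | false = refl
  ...   | true rewrite <ᵇ-true {b} {x} (<-≤-trans (<ᵇ-true⁻ b mx eb) (<ᵇ-false⁻ x mx ex)) = refl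
  scanNonLRMax-∷ʳ mx r (x ∷ xs) b | true rewrite scanNonLRMax-∷ʳ mx (just x) xs b with b <ᵇ mx in eb
  ... | true = refl
  ... | false rewrite <ᵇ-false {b} {x} (≤-trans (<⇒≤ (<ᵇ-true⁻ x mx ex)) (<ᵇ-false⁻ b mx eb)) = refl

  lowest-∷ʳ : ∀ xs b → lowest (xs ∷ʳ b) ≡ (if anyAbove b xs then b else lowest xs)
  lowest-∷ʳ xs b rewrite scanNonLRMax-∷ʳ 0 nothing xs b with anyAbove b xs
  ... | true  = refl
  ... | false = refl

  scanNonLRMax-≤ : ∀ {N} mx r {w} → fromMaybe 0 r ≤ N → All (_≤ N) w → fromMaybe 0 (scanNonLRMax mx r w) ≤ N
  scanNonLRMax-≤ mx r p []       = p
  scanNonLRMax-≤ mx r {a ∷ as} p (q ∷ qs) with a <ᵇ mx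
  ... | true  = scanNonLRMax-≤ mx (just a) q qs
  ... | false = scanNonLRMax-≤ a r p qs

  -- In a 321-avoiding word the entries that are not left-to-right maxima are weakly increasing, so the last of them
  -- is the largest.
  inversionAbove-lowest : ∀ v w → avoids321 w ≡ true → inversionAbove v w ≡ (v <ᵇ lowest w)
  inversionAbove-lowest v w = go v (reverseView w)
    where
    go : ∀ v {w} → Reverse w → avoids321 w ≡ true → inversionAbove v w ≡ (v <ᵇ lowest w)
    go v []             _  = refl
    go v (xs ∶ rs ∶ʳ b) av
      rewrite avoids321-∷ʳ xs b | inversionAbove-∷ʳ v xs b | lowest-∷ʳ xs b
      with ∧-true⁻ (avoids321 xs) av
    -- By induction `noInv` says that `b` is not below `lowest xs`, so the cases with
    -- `b <ᵇ lowest xs` true are absurd. If some earlier entry exceeds `b`, then `b` becomes the new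
    -- `lowest`, and it is at least the old one.
    ... | avxs , noInv rewrite go v rs avxs | go b rs avxs with anyAbove b xs | b <ᵇ lowest xs in e
    ...   | false | false rewrite ∧-zeroʳ (v <ᵇ b) = ∨-identityʳ _
    ...   | true  | false with v <ᵇ b in e′ | v <ᵇ lowest xs in e″
    ...     | true  | true  = refl
    ...     | true  | false = refl
    ...     | false | false = refl
    ...     | false | true  =
      contradiction (<-≤-trans (<ᵇ-true⁻ v (lowest xs) e″)
        (≤-trans (<ᵇ-false⁻ b (lowest xs) e) (<ᵇ-false⁻ v b e′))) (<-irrefl refl)

  -- Invariance under order embeddings.

  module _ (g : ℕ → ℕ) (mono : ∀ x y → (g x <ᵇ g y) ≡ (x <ᵇ y)) where

    anyBelow-map : ∀ b ys → anyBelow (g b) (map g ys) ≡ anyBelow b ys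
    anyBelow-map b []       = refl
    anyBelow-map b (y ∷ ys) = cong₂ _∨_ (mono y b) (anyBelow-map b ys)

    has21Below-map : ∀ a bs → has21Below (g a) (map g bs) ≡ has21Below a bs
    has21Below-map a []       = refl
    has21Below-map a (b ∷ bs) = cong₂ _∨_ (cong₂ _∧_ (mono b a) (anyBelow-map b bs)) (has21Below-map a bs)

    avoids321-map : ∀ as → avoids321 (map g as) ≡ avoids321 as
    avoids321-map []       = refl
    avoids321-map (a ∷ as) = cong₂ _∧_ (cong not (has21Below-map a as)) (avoids321-map as)

    shrubCond-map : ∀ as → shrubCond (map g as) ≡ shrubCond as
    shrubCond-map []               = refl
    shrubCond-map (_ ∷ [])         = refl
    shrubCond-map (_ ∷ _ ∷ [])     = refl
    shrubCond-map (a ∷ b ∷ c ∷ as) = cong₂ _∧_ (mono a b) (cong₂ _∧_ (mono a c) (shrubCond-map as))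

    module _ (v v′ : ℕ) (shift : ∀ x → (v′ <ᵇ g x) ≡ (v <ᵇ x)) where

      descentBelow-map : ∀ a bs → descentBelow v′ (g a) (map g bs) ≡ descentBelow v a bs
      descentBelow-map a []       = refl
      descentBelow-map a (b ∷ bs) = cong₂ _∨_ (cong₂ _∧_ (mono b a) (shift b)) (descentBelow-map a bs)

      inversionAbove-map : ∀ as → inversionAbove v′ (map g as) ≡ inversionAbove v as
      inversionAbove-map []       = refl
      inversionAbove-map (a ∷ as) = cong₂ _∨_ (descentBelow-map a as) (inversionAbove-map as)

  suc<bump : ∀ v x → (suc v <ᵇ bump v x) ≡ (v <ᵇ x)
  suc<bump v x with v <ᵇ x in ex
  ... | true  = ex
  ... | false = <ᵇ-false (≤-trans (<ᵇ-false⁻ v x ex) (n≤1+n v))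

  bump<suc : ∀ v x → (bump v x <ᵇ suc v) ≡ (x <ᵇ suc v)
  bump<suc v x with v <ᵇ x in ex
  ... | true  = trans (<ᵇ-false (<⇒≤ v<x)) (sym (<ᵇ-false v<x))
    where v<x = <ᵇ-true⁻ v x ex
  ... | false = refl

  -- Bumping preserves order, so only a 321 ending in the new letter can arise; the inversion it
  -- needs is controlled by `lowest π`.
  avoids321-app : ∀ v π → avoids321 (app v π) ≡ avoids321 π ∧ not (v <ᵇ lowest π)
  avoids321-app v π
    rewrite avoids321-∷ʳ (map (bump v) π) (suc v) | avoids321-map (bump v) (bump-< v) π
          | inversionAbove-map (bump v) (bump-< v) v (suc v) (suc<bump v) π
    with avoids321 π in av
  ... | true  = cong not (inversionAbove-lowest v π av)
  ... | false = refl

  anyAbove-∈ : ∀ {v x} {xs} → v < x → x ∈ xs → anyAbove v xs ≡ true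
  anyAbove-∈ v<x (here refl) rewrite <ᵇ-true v<x = refl
  anyAbove-∈ {v} {xs = y ∷ ys} v<x (there x∈) with v <ᵇ y
  ... | true  = refl
  ... | false = anyAbove-∈ v<x x∈

  anyAbove-≤ : ∀ {v xs} → All (_≤ v) xs → anyAbove v xs ≡ false
  anyAbove-≤ []       = refl
  anyAbove-≤ (p ∷ ps) rewrite <ᵇ-false p = anyAbove-≤ ps

  -- Either the last letter is the maximum, or bumping carries the maximum of the shorter
  -- permutation to it. This witnesses that a smaller appended letter is not a left-to-right
  -- maximum.
  max∈ : ∀ {N w} → IsPerm (suc N) w → suc N ∈ w
  max∈ {N} p with app-surjective p
  max∈ {zero} p | zero , π , z≤n , q , refl = ∈-++⁺ʳ (map (bump zero) π) (here refl)
  max∈ {suc N} p | v , π , v≤N , q , refl with v ≟ suc N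
  ... | yes refl = ∈-++⁺ʳ (map (bump v) π) (here refl)
  ... | no v≢sN = ∈-++⁺ˡ (subst (_∈ map (bump v) π) bump-max (∈-map⁺ (bump v) (max∈ q)))
    where
    bump-max : bump v (suc N) ≡ suc (suc N)
    bump-max rewrite <ᵇ-true {v} {suc N} (≤∧≢⇒< v≤N v≢sN) = refl

  -- No old entry is raised, and the new one is a left-to-right maximum.
  lowest-app-max : ∀ {N π} → IsPerm N π → lowest (app N π) ≡ lowest π
  lowest-app-max {N} {π} (isPerm _ r _) = trans (lowest-∷ʳ (map (bump N) π) (suc N))
    (subst (λ w → (if anyAbove (suc N) w then suc N else lowest w) ≡ lowest π) (sym fixed)
      (cong (λ b → if b then suc N else lowest π) (anyAbove-≤ {suc N} (All.map (λ p → m≤n⇒m≤1+n (proj₂ p)) r))))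
    where
    bump-small : ∀ {x} → x ≤ N → bump N x ≡ x
    bump-small {x} x≤N rewrite <ᵇ-false {N} {x} x≤N = refl
    fixed : map (bump N) π ≡ π
    fixed = map-id-local (All.map (λ p → bump-small (proj₂ p)) r)

  lowest-app : ∀ {v N π} → v < N → IsPerm N π → lowest (app v π) ≡ suc v
  lowest-app {v} {suc N} {π} v<N p = trans (lowest-∷ʳ (map (bump v) π) (suc v))
    (cong (λ b → if b then suc v else lowest (map (bump v) π))
      (anyAbove-∈ (≤-trans (s≤s v<N) (≤-reflexive (sym bump-max))) (∈-map⁺ (bump v) (max∈ p))))
    where
    bump-max : bump v (suc N) ≡ suc (suc N)
    bump-max rewrite <ᵇ-true v<N = refl

  lowest-≤ : ∀ {N w} → IsPerm N w → lowest w ≤ N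
  lowest-≤ (isPerm _ r _) = scanNonLRMax-≤ 0 nothing z≤n (All.map proj₂ r)

  listEq⇒≡ : ∀ as bs → listEq as bs ≡ true → as ≡ bs
  listEq⇒≡ []       []       _ = refl
  listEq⇒≡ (a ∷ as) (b ∷ bs) e with ∧-true⁻ (a ≡ᵇ b) e
  ... | p , q = cong₂ _∷_ (≡ᵇ-true⁻ a b p) (listEq⇒≡ as bs q)

  -- Serves the identity permutation: nothing is found, and the default 0 of `lowest` agrees with
  -- the convention that its lif is `N`.
  scanNonLRMax-increasing : ∀ f mx n → (∀ i → mx ≤ f i) → (∀ i j → i ≤ j → f i ≤ f j) →
    scanNonLRMax mx nothing (applyUpTo f n) ≡ nothing
  scanNonLRMax-increasing f mx zero    low mono = refl
  scanNonLRMax-increasing f mx (suc n) low mono rewrite <ᵇ-false (low 0) =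
    scanNonLRMax-increasing (f ∘ suc) (f 0) n (λ i → mono 0 (suc i) z≤n) (λ i j i≤j → mono (suc i) (suc j) (s≤s i≤j))

  lif-lowest : ∀ N π → lif N π ≡ N ∸ lowest π
  lif-lowest N π with listEq π (oneTo N) in e
  ... | true rewrite listEq⇒≡ π (oneTo N) e | oneTo-upTo N
                   | scanNonLRMax-increasing suc 0 N (λ _ → z≤n) (λ i j → s≤s) = refl
  ... | false rewrite lastNonLRMax-scanNonLRMax π with scanNonLRMax 0 nothing π
  ...   | just v  = refl
  ...   | nothing = refl

  -- The new lif when m old entries lie above the appended one.
  step : ℕ → ℕ → ℕ
  step L zero    = suc L
  step L (suc m) = suc m

  lif-app : ∀ {N m π} → m ≤ N → IsPerm N π → lif (suc N) (app (N ∸ m) π) ≡ step (lif N π) m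
  lif-app {N} {zero} {π} _ p rewrite lif-lowest (suc N) (app N π) | lif-lowest N π | lowest-app-max p =
    -- The length grows by one while `lowest` stays; `lowest π ≤ N` keeps the truncated subtraction
    -- exact.
    +-∸-assoc 1 (lowest-≤ p)
  lif-app {N} {suc m} {π} m<N p rewrite lif-lowest (suc N) (app (N ∸ suc m) π)
    | lowest-app (∸-monoʳ-< {N} {suc m} {0} (s≤s z≤n) m<N) p = m∸[m∸n]≡n m<N

  ∸-<ᵇ : ∀ {M a b} → a ≤ M → b ≤ M → (M ∸ a <ᵇ M ∸ b) ≡ (b <ᵇ a)
  ∸-<ᵇ {M} {a} {b} a≤M b≤M with b <ᵇ a in e
  ... | true  = <ᵇ-true (∸-monoʳ-< (<ᵇ-true⁻ b a e) a≤M)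
  ... | false = <ᵇ-false (∸-monoʳ-≤ M (<ᵇ-false⁻ b a e))

  not-<ᵇ : ∀ m n → not (m <ᵇ n) ≡ (n <ᵇ suc m)
  not-<ᵇ m       zero    = refl
  not-<ᵇ zero    (suc n) = refl
  not-<ᵇ (suc m) (suc n) = not-<ᵇ m n

  -- The condition that `N ∸ m` is not below `lowest π` becomes a bound on `m` after complementing
  -- both sides in `N`.
  avoids321-app-lif : ∀ {N m π} → m ≤ N → IsPerm N π →
    avoids321 (app (N ∸ m) π) ≡ avoids321 π ∧ (m <ᵇ suc (lif N π))
  avoids321-app-lif {N} {m} {π} m≤N p = trans (avoids321-app (N ∸ m) π) (cong (avoids321 π ∧_) (begin
    not (N ∸ m <ᵇ lowest π)             ≡⟨ cong (λ t → not (N ∸ m <ᵇ t)) (sym (m∸[m∸n]≡n (lowest-≤ p))) ⟩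
    not (N ∸ m <ᵇ N ∸ (N ∸ lowest π))   ≡⟨ cong not (∸-<ᵇ m≤N (m∸n≤m N (lowest π))) ⟩
    not (N ∸ lowest π <ᵇ m)             ≡⟨ not-<ᵇ (N ∸ lowest π) m ⟩
    (m <ᵇ suc (N ∸ lowest π))           ≡⟨ cong (λ ℓ → m <ᵇ suc ℓ) (sym (lif-lowest N π)) ⟩
    (m <ᵇ suc (lif N π))                ∎))
    where open ≡-Reasoning

  -- Guarded and truncated sums.

  Σ<-cong : ∀ n {f g : ℕ → ℕ} → (∀ {m} → m < n → f m ≡ g m) → Σ< n f ≡ Σ< n g
  Σ<-cong zero    eq = refl
  Σ<-cong (suc n) eq = cong₂ _+_ (eq (s≤s z≤n)) (Σ<-cong n (λ m<n → eq (s≤s m<n)))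

  Σ<-zero : ∀ n → Σ< n (λ _ → 0) ≡ 0
  Σ<-zero zero    = refl
  Σ<-zero (suc n) = Σ<-zero n

  Σ<-guard : ∀ n b (f : ℕ → ℕ) → Σ< n (λ m → guard b (f m)) ≡ guard b (Σ< n f)
  Σ<-guard n true  f = refl
  Σ<-guard n false f = Σ<-zero n

  Σ<-truncate : ∀ {n B} (f : ℕ → ℕ) → B ≤ n → Σ< n (λ m → guard (m <ᵇ B) (f m)) ≡ Σ< B f
  Σ<-truncate {n} f z≤n       = Σ<-zero n
  Σ<-truncate     f (s≤s B≤n) = cong (f 0 +_) (Σ<-truncate (f ∘ suc) B≤n)

  guard-∧ : ∀ a {b x} → guard (a ∧ b) x ≡ guard a (guard b x)
  guard-∧ true  = refl
  guard-∧ false = refl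

  <ᵇ-⊓ : ∀ m a b → (m <ᵇ suc (a ⊓ b)) ≡ (m <ᵇ suc a) ∧ (m <ᵇ suc b)
  <ᵇ-⊓ zero    a       b       = refl
  <ᵇ-⊓ (suc m) zero    b       = refl
  <ᵇ-⊓ (suc m) (suc a) zero    = sym (∧-zeroʳ _)
  <ᵇ-⊓ (suc m) (suc a) (suc b) = <ᵇ-⊓ m a b

  -- Appending a shrub

  -- Because the length of `xs` is a multiple of three, the appended letters form a block of their
  -- own.
  shrubCond-∷ʳ³ : ∀ n xs a b c → length xs ≡ n * 3 →
    shrubCond (xs ∷ʳ a ∷ʳ b ∷ʳ c) ≡ shrubCond xs ∧ ((a <ᵇ b) ∧ (a <ᵇ c))
  shrubCond-∷ʳ³ zero    []               a b c _ with a <ᵇ b | a <ᵇ c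
  ... | true  | true  = refl
  ... | true  | false = refl
  ... | false | _     = refl
  shrubCond-∷ʳ³ (suc n) (x ∷ y ∷ z ∷ xs) a b c l
    rewrite shrubCond-∷ʳ³ n xs a b c (suc-injective (suc-injective (suc-injective l))) =
    trans (cong ((x <ᵇ y) ∧_) (sym (∧-assoc (x <ᵇ z) _ _))) (sym (∧-assoc (x <ᵇ y) _ _))

  map-∷ʳ : ∀ (f : ℕ → ℕ) xs x → map f (xs ∷ʳ x) ≡ map f xs ∷ʳ f x
  map-∷ʳ f xs x = map-++ f xs _

  app³ : ℕ → ℕ → ℕ → List ℕ → List ℕ
  app³ v₁ v₂ v₃ π = app v₃ (app v₂ (app v₁ π))

  shrubCond-app³ : ∀ n v₁ v₂ v₃ π → length π ≡ n * 3 →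
    shrubCond (app³ v₁ v₂ v₃ π) ≡ shrubCond π ∧ ((v₁ <ᵇ v₂) ∧ (v₁ <ᵇ v₃))
  shrubCond-app³ n v₁ v₂ v₃ π l = begin
    shrubCond (app³ v₁ v₂ v₃ π)
      ≡⟨ cong (λ w → shrubCond (w ∷ʳ suc v₃)) expand ⟩
    shrubCond (xs ∷ʳ b₃ (b₂ (suc v₁)) ∷ʳ b₃ (suc v₂) ∷ʳ suc v₃)
      ≡⟨ shrubCond-∷ʳ³ n xs _ _ _
          (trans (length-map b₃ (map b₂ (map b₁ π))) (trans (length-map b₂ (map b₁ π)) (trans (length-map b₁ π) l))) ⟩
    shrubCond xs ∧ ((b₃ (b₂ (suc v₁)) <ᵇ b₃ (suc v₂)) ∧ (b₃ (b₂ (suc v₁)) <ᵇ suc v₃))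
      ≡⟨ cong₂ _∧_
          (trans (shrubCond-map b₃ (bump-< v₃) (map b₂ (map b₁ π)))
            (trans (shrubCond-map b₂ (bump-< v₂) (map b₁ π)) (shrubCond-map b₁ (bump-< v₁) π)))
          (cong₂ _∧_ (trans (bump-< v₃ (b₂ (suc v₁)) (suc v₂)) (bump<suc v₂ (suc v₁))) (bump<suc v₃ (b₂ (suc v₁)))) ⟩
    shrubCond π ∧ ((v₁ <ᵇ v₂) ∧ (b₂ (suc v₁) <ᵇ suc v₃))
      ≡⟨ cong (shrubCond π ∧_) unbumped ⟩
    shrubCond π ∧ ((v₁ <ᵇ v₂) ∧ (v₁ <ᵇ v₃)) ∎
    where
    open ≡-Reasoning
    b₁ = bump v₁
    b₂ = bump v₂
    b₃ = bump v₃
    xs = map b₃ (map b₂ (map b₁ π))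
    expand : map b₃ (app v₂ (app v₁ π)) ≡ xs ∷ʳ b₃ (b₂ (suc v₁)) ∷ʳ b₃ (suc v₂)
    expand = trans (map-∷ʳ b₃ (map b₂ (app v₁ π)) _) (cong (_∷ʳ b₃ (suc v₂))
      (trans (cong (map b₃) (map-∷ʳ b₂ (map b₁ π) _)) (map-∷ʳ b₃ (map b₂ (map b₁ π)) _)))
    -- If `v₁ < v₂`, the second insertion does not raise the root `suc v₁`; otherwise both
    -- conjunctions are false.
    unbumped : (v₁ <ᵇ v₂) ∧ (b₂ (suc v₁) <ᵇ suc v₃) ≡ (v₁ <ᵇ v₂) ∧ (v₁ <ᵇ v₃)
    unbumped with v₁ <ᵇ v₂ in e
    ... | false = refl
    ... | true rewrite <ᵇ-false {v₂} {suc v₁} (<ᵇ-true⁻ v₁ v₂ e) = refl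

  valid : List ℕ → Bool
  valid π = avoids321 π ∧ shrubCond π

  -- Avoidance bounds each parameter by the current lif, and the shrub condition adds `m₂ ≤ m₁` and
  -- `m₃ ≤ suc m₁`; the minima merge the two kinds of bounds.
  valid-app³ : ∀ n {N π m₁ m₂ m₃} → N ≡ n * 3 → IsPerm N π → m₁ ≤ N → m₂ ≤ suc N → m₃ ≤ suc (suc N) →
    let L  = lif N π
        L₁ = step L m₁
        L₂ = step L₁ m₂
        w  = app³ (N ∸ m₁) (suc N ∸ m₂) (suc (suc N) ∸ m₃) π
    in (valid w ≡ valid π ∧ ((m₁ <ᵇ suc L) ∧ ((m₂ <ᵇ suc (L₁ ⊓ m₁)) ∧ (m₃ <ᵇ suc (L₂ ⊓ suc m₁)))))
       × lif (3 + N) w ≡ step L₂ m₃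
  valid-app³ n {N} {π} {m₁} {m₂} {m₃} N≡ p ≤₁ ≤₂ ≤₃
    rewrite shrubCond-app³ n (N ∸ m₁) (suc N ∸ m₂) (suc (suc N) ∸ m₃) π (trans (IsPerm.len p) N≡)
          | avoids321-app-lif ≤₃ (app-isPerm (m∸n≤m (suc N) m₂) (app-isPerm (m∸n≤m N m₁) p))
          | avoids321-app-lif ≤₂ (app-isPerm (m∸n≤m N m₁) p)
          | avoids321-app-lif ≤₁ p
          | lif-app ≤₃ (app-isPerm (m∸n≤m (suc N) m₂) (app-isPerm (m∸n≤m N m₁) p))
          | lif-app ≤₂ (app-isPerm (m∸n≤m N m₁) p)
          | lif-app ≤₁ p
          -- Writing `N ∸ m₁` as `suc N ∸ suc m₁`, and next as `suc (suc N) ∸ suc (suc m₁)`, gives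
          -- both sides the same minuend, so the comparison turns into one of the parameters.
          | ∸-<ᵇ {suc N} {suc m₁} {m₂} (s≤s ≤₁) ≤₂
          | ∸-<ᵇ {suc (suc N)} {suc (suc m₁)} {m₃} (s≤s (s≤s ≤₁)) ≤₃
          | <ᵇ-⊓ m₂ (step (lif N π) m₁) m₁
          | <ᵇ-⊓ m₃ (step (step (lif N π) m₁) m₂) (suc m₁)
    = rearrange (avoids321 π) (shrubCond π) _ _ _ _ _ , refl
    where
    rearrange : ∀ a s c₁ c₂ c₃ d e →
      (((a ∧ c₁) ∧ c₂) ∧ c₃) ∧ (s ∧ (d ∧ e)) ≡ (a ∧ s) ∧ (c₁ ∧ ((c₂ ∧ d) ∧ (c₃ ∧ e)))
    rearrange false s     c₁    c₂    c₃    d e = refl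
    rearrange true  s     false c₂    c₃    d e = sym (∧-zeroʳ s)
    rearrange true  s     true  false c₃    d e = sym (∧-zeroʳ s)
    rearrange true  s     true  true  true  d e = refl
    rearrange true  false true  true  false d e = refl
    rearrange true  true  true  true  false d e = sym (∧-zeroʳ d)

  -- Summing over forests, shrub by shrub.

  lif-≤ : ∀ N π → lif N π ≤ N
  lif-≤ N π = subst (_≤ N) (sym (lif-lowest N π)) (m∸n≤m N (lowest π))

  -- Validity is a factor of the summand rather than a filter on the list: with an incomplete shrub
  -- `shrubCond` is false, so filtered lists could not be grown letter by letter.
  weight : ℕ → (ℕ → ℕ) → List ℕ → ℕ
  weight N f π = guard (valid π) (f (lif N π))

  childSum : (ℕ → ℕ) → ℕ → ℕ
  childSum f L =
    Σ< (suc L) λ m₁ →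
    Σ< (suc (step L m₁ ⊓ m₁)) λ m₂ →
    Σ< (suc (step (step L m₁) m₂ ⊓ suc m₁)) λ m₃ →
    f (step (step (step L m₁) m₂) m₃)

  -- The guard for each parameter does not involve the later ones, so it leaves the inner sums and
  -- then cuts the range of its own sum.
  Σ<-weight-app³ : ∀ n {N π} f → N ≡ n * 3 → IsPerm N π →
    (Σ< (suc N) λ m₁ → Σ< (2 + N) λ m₂ → Σ< (3 + N) λ m₃ →
      weight (3 + N) f (app³ (N ∸ m₁) (suc N ∸ m₂) (suc (suc N) ∸ m₃) π))
    ≡ weight N (childSum f) π
  Σ<-weight-app³ n {N} {π} f N≡ p = begin
    _ ≡⟨ Σ<-cong (suc N) (λ <₁ → summand₁ (≤-pred <₁)) ⟩
    Σ< (suc N) (λ m₁ → guard (valid π) (guard (m₁ <ᵇ suc L) (sum₁ m₁)))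
      ≡⟨ Σ<-guard (suc N) (valid π) (λ m₁ → guard (m₁ <ᵇ suc L) (sum₁ m₁)) ⟩
    guard (valid π) (Σ< (suc N) (λ m₁ → guard (m₁ <ᵇ suc L) (sum₁ m₁)))
      ≡⟨ cong (guard (valid π)) (Σ<-truncate sum₁ (s≤s (lif-≤ N π))) ⟩
    weight N (childSum f) π ∎
    where
    open ≡-Reasoning
    L = lif N π
    summand : ℕ → ℕ → ℕ → ℕ
    summand m₁ m₂ m₃ = f (step (step (step L m₁) m₂) m₃)
    sum₂ : ℕ → ℕ → ℕ
    sum₂ m₁ m₂ = Σ< (suc (step (step L m₁) m₂ ⊓ suc m₁)) (summand m₁ m₂)
    sum₁ : ℕ → ℕ
    sum₁ m₁ = Σ< (suc (step L m₁ ⊓ m₁)) (sum₂ m₁)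
    c₁ : ℕ → Bool
    c₁ m₁ = m₁ <ᵇ suc L
    c₂ : ℕ → ℕ → Bool
    c₂ m₁ m₂ = m₂ <ᵇ suc (step L m₁ ⊓ m₁)

    summand₃ : ∀ {m₁ m₂ m₃} → m₁ ≤ N → m₂ ≤ suc N → m₃ ≤ 2 + N →
      weight (3 + N) f (app³ (N ∸ m₁) (suc N ∸ m₂) (suc (suc N) ∸ m₃) π) ≡
      guard (valid π) (guard (c₁ m₁) (guard (c₂ m₁ m₂)
        (guard (m₃ <ᵇ suc (step (step L m₁) m₂ ⊓ suc m₁)) (summand m₁ m₂ m₃))))
    summand₃ {m₁} {m₂} ≤₁ ≤₂ ≤₃ with valid-app³ n N≡ p ≤₁ ≤₂ ≤₃
    ... | v , l rewrite v | l = trans (guard-∧ (valid π))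
      (cong (guard (valid π)) (trans (guard-∧ (c₁ m₁)) (cong (guard (c₁ m₁)) (guard-∧ (c₂ m₁ m₂)))))

    summand₂ : ∀ {m₁ m₂} → m₁ ≤ N → m₂ ≤ suc N →
      (Σ< (3 + N) λ m₃ → weight (3 + N) f (app³ (N ∸ m₁) (suc N ∸ m₂) (suc (suc N) ∸ m₃) π)) ≡
      guard (valid π) (guard (c₁ m₁) (guard (c₂ m₁ m₂) (sum₂ m₁ m₂)))
    summand₂ {m₁} {m₂} ≤₁ ≤₂ =
      trans (Σ<-cong (3 + N) (λ <₃ → summand₃ ≤₁ ≤₂ (≤-pred <₃)))
      (trans (Σ<-guard (3 + N) (valid π) (λ m₃ → guard (c₁ m₁) (guard (c₂ m₁ m₂) (t m₃)))) (cong (guard (valid π))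
      (trans (Σ<-guard (3 + N) (c₁ m₁) (λ m₃ → guard (c₂ m₁ m₂) (t m₃))) (cong (guard (c₁ m₁))
      (trans (Σ<-guard (3 + N) (c₂ m₁ m₂) t) (cong (guard (c₂ m₁ m₂))
      (Σ<-truncate (summand m₁ m₂)
        (s≤s (≤-trans (m⊓n≤n (step (step L m₁) m₂) (suc m₁)) (s≤s (m≤n⇒m≤1+n ≤₁)))))))))))
      where
      t : ℕ → ℕ
      t m₃ = guard (m₃ <ᵇ suc (step (step L m₁) m₂ ⊓ suc m₁)) (summand m₁ m₂ m₃)

    summand₁ : ∀ {m₁} → m₁ ≤ N →
      (Σ< (2 + N) λ m₂ → Σ< (3 + N) λ m₃ →
        weight (3 + N) f (app³ (N ∸ m₁) (suc N ∸ m₂) (suc (suc N) ∸ m₃) π)) ≡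
      guard (valid π) (guard (c₁ m₁) (sum₁ m₁))
    summand₁ {m₁} ≤₁ =
      trans (Σ<-cong (2 + N) (λ <₂ → summand₂ ≤₁ (≤-pred <₂)))
      (trans (Σ<-guard (2 + N) (valid π) (λ m₂ → guard (c₁ m₁) (t m₂))) (cong (guard (valid π))
      (trans (Σ<-guard (2 + N) (c₁ m₁) t) (cong (guard (c₁ m₁))
      (Σ<-truncate (sum₂ m₁) (s≤s (≤-trans (m⊓n≤n (step L m₁) m₁) (m≤n⇒m≤1+n ≤₁))))))))
      where
      t : ℕ → ℕ
      t m₂ = guard (c₂ m₁ m₂) (sum₂ m₁ m₂)

  -- The size is written `n * 3` because `suc n * 3` reduces to `3 + n * 3`, ready for three
  -- insertions.
  sum-weight-step : ∀ n f →
    sum (map (weight (3 + n * 3) f) (allPerms (3 + n * 3))) ≡ sum (map (weight (n * 3) (childSum f)) (allPerms (n * 3)))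
  sum-weight-step n f = begin
    sum (map F (allPerms (3 + N)))
      ≡⟨ sum-allPerms (2 + N) F ⟩
    sum (map (λ π → Σ< (3 + N) λ m₃ → F (app (2 + N ∸ m₃) π)) (allPerms (2 + N)))
      ≡⟨ sum-allPerms (1 + N) _ ⟩
    sum (map (λ π → Σ< (2 + N) λ m₂ → Σ< (3 + N) λ m₃ → F (app (2 + N ∸ m₃) (app (1 + N ∸ m₂) π))) (allPerms (1 + N)))
      ≡⟨ sum-allPerms N _ ⟩
    sum (map (λ π → Σ< (1 + N) λ m₁ → Σ< (2 + N) λ m₂ → Σ< (3 + N) λ m₃ →
      F (app³ (N ∸ m₁) (1 + N ∸ m₂) (2 + N ∸ m₃) π)) (allPerms N))
      ≡⟨ cong sum (map-cong-local (All.tabulate (λ π∈ → Σ<-weight-app³ n f refl (∈-allPerms⁻ π∈)))) ⟩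
    sum (map (weight N (childSum f)) (allPerms N)) ∎
    where
    open ≡-Reasoning
    N = n * 3
    F = weight (3 + N) f

  δ : ℕ → ℕ → ℕ
  δ i j = if i ≡ᵇ j then 1 else 0

  sum-map-filter : ∀ {A : Set} (b : A → Bool) (f : A → ℕ) xs →
    sum (map f (filter (λ x → b x ≟ᵇ true) xs)) ≡ sum (map (λ x → guard (b x) (f x)) xs)
  sum-map-filter b f []       = refl
  sum-map-filter b f (x ∷ xs) with b x
  ... | true  = cong (f x +_) (sum-map-filter b f xs)
  ... | false = sum-map-filter b f xs

  length-filter-sum : ∀ {A : Set} (b : A → Bool) xs →
    length (filter (λ x → b x ≟ᵇ true) xs) ≡ sum (map (λ x → guard (b x) 1) xs)
  length-filter-sum b []       = refl
  length-filter-sum b (x ∷ xs) with b x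
  ... | true  = cong suc (length-filter-sum b xs)
  ... | false = length-filter-sum b xs

  -- The functional equation sees the forests only through this list of lif values.
  lifs : ℕ → List ℕ
  lifs n = map (lif (3 * n)) (S2-321 n)

  lifs-≤ : ∀ n → All (_≤ 3 * n) (lifs n)
  lifs-≤ n = All.map⁺ (All.universal (lif-≤ (3 * n)) (S2-321 n))

  h-lifs : ∀ n k → h n k ≡ sum (map (λ ℓ → δ ℓ k) (lifs n))
  h-lifs n k = trans (length-filter-sum (λ σ → lif (3 * n) σ ≡ᵇ k) (S2-321 n)) (cong sum (map-∘ (S2-321 n)))

  sum-lifs : ∀ n f → sum (map f (lifs n)) ≡ sum (map (weight (n * 3) f) (allPerms (n * 3)))
  sum-lifs n f = begin
    sum (map f (lifs n))                              ≡⟨ cong sum (sym (map-∘ (S2-321 n))) ⟩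
    sum (map (f ∘ lif (3 * n)) (S2-321 n))            ≡⟨ sum-map-filter valid (f ∘ lif (3 * n)) (allPerms (3 * n)) ⟩
    sum (map (weight (3 * n) f) (allPerms (3 * n)))   ≡⟨ cong (λ N → sum (map (weight N f) (allPerms N))) (*-comm 3 n) ⟩
    sum (map (weight (n * 3) f) (allPerms (n * 3)))   ∎
    where open ≡-Reasoning

  sum-lifs-suc : ∀ n f → sum (map f (lifs (suc n))) ≡ sum (map (childSum f) (lifs n))
  sum-lifs-suc n f = trans (sum-lifs (suc n) f) (trans (sum-weight-step n f) (sym (sum-lifs n (childSum f))))

open Insertion
open import Data.Integer as ℤ using (+_; -[1+_])
import Data.Integer.Properties as ℤ
import Data.Nat.Tactic.RingSolver as ℕ-Solver
open import Data.Rational using (ℚ; 0ℚ; 1ℚ; ½; _+_; _*_; -_; toℚᵘ)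
open import Data.Rational.Properties
  using (+-identityˡ; +-identityʳ; *-identityˡ; *-identityʳ; *-zeroˡ; *-zeroʳ; *-distribˡ-+; +-assoc; +-comm
        ; toℚᵘ-injective; toℚᵘ-fromℚᵘ; toℚᵘ-homo-+)
open import Data.Rational.Solver using (module +-*-Solver)
open import Data.Rational.Unnormalised as ℚᵘ using (mkℚᵘ; _≃_; *≡*)
import Data.Rational.Unnormalised.Properties as ℚᵘ

-- The number of outcomes of appending a shrub

δ-Σ< : ∀ r k → Σ< r (λ j → δ j k) ≡ guard (k <ᵇ r) 1
δ-Σ< zero    k       = refl
δ-Σ< (suc r) zero    = cong suc (Σ<-zero r)
δ-Σ< (suc r) (suc k) = δ-Σ< r k

-- The indicator of 1 ≤ k ≤ r.
upTo-indicator : ℕ → ℕ → ℕ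
upTo-indicator r zero    = 0
upTo-indicator r (suc k) = guard (k <ᵇ r) 1

guard-suc : ∀ r k → δ r k ℕ.+ guard (k <ᵇ r) 1 ≡ guard (k <ᵇ suc r) 1
guard-suc zero    zero    = refl
guard-suc zero    (suc k) = refl
guard-suc (suc r) zero    = refl
guard-suc (suc r) (suc k) = guard-suc r k

-- For `m` = 0, 1, ..., r the values of `step r m` are r + 1, 1, ..., r, so each number from 1 to r
-- + 1 occurs once.
Σ<-step : ∀ r k → Σ< (suc r) (λ m → δ (step r m) k) ≡ upTo-indicator (suc r) k
Σ<-step r zero    = Σ<-zero r
Σ<-step r (suc k) = trans (cong (δ r k ℕ.+_) (δ-Σ< r k)) (guard-suc r k)

-- The outcomes with m₁ = m + 1.
row : ℕ → ℕ → ℕ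
row m zero          = 0
row m (suc zero)    = suc (suc m)
row m (suc (suc i)) = suc (suc m) ∸ i

Σ<-one : ∀ n → Σ< n (λ _ → 1) ≡ n
Σ<-one zero    = refl
Σ<-one (suc n) = cong suc (Σ<-one n)

Σ<-indicator : ∀ n i → Σ< n (λ j → guard (i <ᵇ suc j) 1) ≡ n ∸ i
Σ<-indicator zero    zero    = refl
Σ<-indicator zero    (suc i) = refl
Σ<-indicator (suc n) zero    = cong suc (Σ<-one n)
Σ<-indicator (suc n) (suc i) = Σ<-indicator n i

guard-∸ : ∀ n i → guard (i <ᵇ suc n) 1 ℕ.+ (n ∸ i) ≡ suc n ∸ i
guard-∸ n       zero    = refl
guard-∸ zero    (suc i) = sym (ℕ.0∸n≡0 i)
guard-∸ (suc n) (suc i) = guard-∸ n i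

-- With `m₁ = m + 1`, the choice `m₂ = 0` yields each lif from 1 to m + 3 once, and `m₂ = j + 1`
-- yields each from 1 to j + 2 once.
row-indicator : ∀ m k → upTo-indicator (3 ℕ.+ m) k ℕ.+ Σ< (suc m) (λ j → upTo-indicator (2 ℕ.+ j) k) ≡ row m k
row-indicator m zero          = Σ<-zero m
row-indicator m (suc zero)    = cong (2 ℕ.+_) (Σ<-one m)
row-indicator m (suc (suc i)) = trans (cong (guard (i <ᵇ 2 ℕ.+ m) 1 ℕ.+_) (Σ<-indicator (suc m) i)) (guard-∸ (suc m) i)

-- For `m₁ = 0` the bounds force `m₂ = 0` and leave `m₃` equal to 0 or 1, with outcomes ℓ + 3 and 1.
-- The rows for positive `m₁` do not depend on ℓ, except that ℓ is their number.
childCount : ℕ → ℕ → ℕ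
childCount ℓ k = δ (3 ℕ.+ ℓ) k ℕ.+ (δ 1 k ℕ.+ Σ< ℓ (λ m → row m k))

childSum-δ : ∀ k ℓ → childSum (λ j → δ j k) ℓ ≡ childCount ℓ k
childSum-δ k ℓ = trans (cong₂ ℕ._+_ first (Σ<-cong ℓ (λ {m} _ → rows m))) (ℕ.+-assoc (δ (3 ℕ.+ ℓ) k) (δ 1 k) _)
  where
  first : δ (3 ℕ.+ ℓ) k ℕ.+ (δ 1 k ℕ.+ 0) ℕ.+ 0 ≡ δ (3 ℕ.+ ℓ) k ℕ.+ δ 1 k
  first = trans (ℕ.+-identityʳ _) (cong (δ (3 ℕ.+ ℓ) k ℕ.+_) (ℕ.+-identityʳ _))
  rows : ∀ m → (Σ< (suc (suc m ⊓ suc m)) λ m₂ → Σ< (suc (step (suc m) m₂ ⊓ suc (suc m))) λ m₃ →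
    δ (step (step (suc m) m₂) m₃) k) ≡ row m k
  rows m rewrite ℕ.⊓-idem m = trans (cong₂ ℕ._+_ (Σ<-step (2 ℕ.+ m) k) (Σ<-cong (suc m) inner)) (row-indicator m k)
    where
    inner : ∀ {j} → j < suc m → Σ< (2 ℕ.+ (j ⊓ suc m)) (λ m₃ → δ (step (suc j) m₃) k) ≡ upTo-indicator (2 ℕ.+ j) k
    inner {j} j<m rewrite ℕ.m≤n⇒m⊓n≡m (ℕ.<⇒≤ j<m) = Σ<-step (suc j) k

Σ<-suc : ∀ n f → Σ< (suc n) f ≡ Σ< n f ℕ.+ f n
Σ<-suc zero    f = ℕ.+-comm (f 0) 0
Σ<-suc (suc n) f = trans (cong (f 0 ℕ.+_) (Σ<-suc n (f ∘ suc))) (sym (ℕ.+-assoc (f 0) _ _))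

h-childCount : ∀ n k → h (suc n) k ≡ sum (map (λ ℓ → childCount ℓ k) (lifs n))
h-childCount n k = trans (h-lifs (suc n) k) (trans (sum-lifs-suc n (λ ℓ → δ ℓ k)) (cong sum (map-cong (childSum-δ k) (lifs n))))

-- The embedding of the naturals in the rationals.

toℚᵘ-fromℕℚ : ∀ m → toℚᵘ (fromℕℚ m) ≃ mkℚᵘ (+ m) 0
toℚᵘ-fromℕℚ m = toℚᵘ-fromℚᵘ (mkℚᵘ (+ m) 0)

fromℕℚ-+ : ∀ m n → fromℕℚ (m ℕ.+ n) ≡ fromℕℚ m + fromℕℚ n
fromℕℚ-+ m n = toℚᵘ-injective (begin
  toℚᵘ (fromℕℚ (m ℕ.+ n))                 ≈⟨ toℚᵘ-fromℕℚ (m ℕ.+ n) ⟩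
  mkℚᵘ (+ (m ℕ.+ n)) 0
    ≈⟨ *≡* (cong (ℤ._* + 1) (sym (cong₂ ℤ._+_ (ℤ.*-identityʳ (+ m)) (ℤ.*-identityʳ (+ n))))) ⟩
  mkℚᵘ (+ m) 0 ℚᵘ.+ mkℚᵘ (+ n) 0          ≈⟨ ℚᵘ.+-cong (ℚᵘ.≃-sym (toℚᵘ-fromℕℚ m)) (ℚᵘ.≃-sym (toℚᵘ-fromℕℚ n)) ⟩
  toℚᵘ (fromℕℚ m) ℚᵘ.+ toℚᵘ (fromℕℚ n)    ≈⟨ ℚᵘ.≃-sym (toℚᵘ-homo-+ (fromℕℚ m) (fromℕℚ n)) ⟩
  toℚᵘ (fromℕℚ m + fromℕℚ n)              ∎)
  where open import Relation.Binary.Reasoning.Setoid ℚᵘ.≃-setoid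

fromℕℚ-suc : ∀ m → fromℕℚ (suc m) ≡ 1ℚ + fromℕℚ m
fromℕℚ-suc m = fromℕℚ-+ 1 m

-- Coefficients of the numerators over powers of 1 - u; the subscript is the power.

A₁ A₂ B₁ B₂ C₁ : ℕ → ℚ
A₁ = (Apoly ⊛ inv1-u) 0
A₂ = (Apoly ⊛ inv1-u ⊛ inv1-u) 0
B₁ = (Bpoly ⊛ inv1-u) 0
B₂ = (Bpoly ⊛ inv1-u ⊛ inv1-u) 0
C₁ = (Cpoly ⊛ inv1-u) 0


-- Division by 1 - u takes partial sums, which from the degree on are the value of the polynomial at
-- 1: here -1, and 1 and -1 for B and C.
A₁-tail : ∀ i → A₁ (5 ℕ.+ i) ≡ q -[1+ 0 ]
A₁-tail zero    = refl
A₁-tail (suc i) = trans (cong (_+ 0ℚ) (A₁-tail i)) refl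

B₁-tail : ∀ i → B₁ (5 ℕ.+ i) ≡ 1ℚ
B₁-tail zero    = refl
B₁-tail (suc i) = cong (_+ 0ℚ) (B₁-tail i)

C₁-tail : ∀ i → C₁ (2 ℕ.+ i) ≡ q -[1+ 0 ]
C₁-tail zero    = refl
C₁-tail (suc i) = cong (_+ 0ℚ) (C₁-tail i)

-- The stable partial sums -1 and 1 cancel, so the sum stays at its value for index 4.
A₂+B₂-tail : ∀ i → A₂ (4 ℕ.+ i) + B₂ (4 ℕ.+ i) ≡ 0ℚ
A₂+B₂-tail zero    = refl
A₂+B₂-tail (suc i) = begin
  (A₂ (4 ℕ.+ i) + A₁ (5 ℕ.+ i) * 1ℚ) + (B₂ (4 ℕ.+ i) + B₁ (5 ℕ.+ i) * 1ℚ)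
    ≡⟨ cong₂ (λ a b → (A₂ (4 ℕ.+ i) + a * 1ℚ) + (B₂ (4 ℕ.+ i) + b * 1ℚ)) (A₁-tail i) (B₁-tail i) ⟩
  (A₂ (4 ℕ.+ i) + q -[1+ 0 ]) + (B₂ (4 ℕ.+ i) + 1ℚ)
    ≡⟨ solve 2 (λ a b → (a :+ con (q -[1+ 0 ])) :+ (b :+ con 1ℚ) := a :+ b) refl (A₂ (4 ℕ.+ i)) (B₂ (4 ℕ.+ i)) ⟩
  A₂ (4 ℕ.+ i) + B₂ (4 ℕ.+ i) ≡⟨ A₂+B₂-tail i ⟩
  0ℚ ∎
  where
  open ≡-Reasoning
  open +-*-Solver

-- Multiplication by u^ℓ.
shift : ℕ → (ℕ → ℚ) → ℕ → ℚ
shift zero    a k       = a k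
shift (suc ℓ) a zero    = 0ℚ
shift (suc ℓ) a (suc k) = shift ℓ a k

fallingTerm : ℕ → ℕ → ℚ
fallingTerm ℓ zero    = ½ * fromℕℚ (ℓ ℕ.* (ℓ ∸ 1))
fallingTerm ℓ (suc k) = 0ℚ

-- What one permutation of lif ℓ contributes to the coefficient of u^k in the bracket.
increment : ℕ → ℕ → ℚ
increment ℓ k = shift ℓ A₂ k + B₂ k + C₁ k * fromℕℚ ℓ + fallingTerm ℓ k

linearTerm : ℕ → ℕ → ℚ
linearTerm ℓ zero    = fromℕℚ ℓ
linearTerm ℓ (suc k) = 0ℚ

-- Multiplying A / (1 - u)² by 1 - u leaves A / (1 - u).
shift-A₂ : ∀ ℓ k → shift ℓ A₂ k ≡ shift (suc ℓ) A₂ k + shift ℓ A₁ k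
shift-A₂ zero    zero    = refl
shift-A₂ zero    (suc k) = cong (λ x → A₂ k + x) (*-identityʳ (A₁ (suc k)))
shift-A₂ (suc ℓ) zero    = refl
shift-A₂ (suc ℓ) (suc k) = shift-A₂ ℓ k

fallingTerm-suc : ∀ ℓ k → fallingTerm (suc ℓ) k ≡ fallingTerm ℓ k + linearTerm ℓ k
fallingTerm-suc ℓ (suc k) = refl
fallingTerm-suc ℓ zero    = begin
  ½ * fromℕℚ (suc ℓ ℕ.* ℓ)                             ≡⟨ cong (λ m → ½ * fromℕℚ m) (split ℓ) ⟩
  ½ * fromℕℚ (ℓ ℕ.* (ℓ ∸ 1) ℕ.+ (ℓ ℕ.+ ℓ))
    ≡⟨ cong (½ *_) (trans (fromℕℚ-+ (ℓ ℕ.* (ℓ ∸ 1)) (ℓ ℕ.+ ℓ))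
         (cong (λ x → fromℕℚ (ℓ ℕ.* (ℓ ∸ 1)) + x) (fromℕℚ-+ ℓ ℓ))) ⟩
  ½ * (fromℕℚ (ℓ ℕ.* (ℓ ∸ 1)) + (fromℕℚ ℓ + fromℕℚ ℓ))
    ≡⟨ solve 2 (λ f x → con ½ :* (f :+ (x :+ x)) := con ½ :* f :+ x) refl
         (fromℕℚ (ℓ ℕ.* (ℓ ∸ 1))) (fromℕℚ ℓ) ⟩
  ½ * fromℕℚ (ℓ ℕ.* (ℓ ∸ 1)) + fromℕℚ ℓ               ∎
  where
  open ≡-Reasoning
  open +-*-Solver
  expand : ∀ ℓ → suc (suc ℓ) ℕ.* suc ℓ ≡ suc ℓ ℕ.* ℓ ℕ.+ (suc ℓ ℕ.+ suc ℓ)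
  expand = ℕ-Solver.solve-∀
  split : ∀ ℓ → suc ℓ ℕ.* ℓ ≡ ℓ ℕ.* (ℓ ∸ 1) ℕ.+ (ℓ ℕ.+ ℓ)
  split zero    = refl
  split (suc ℓ) = expand ℓ

-- Differences of `childCount`.

δℚ : ℕ → ℕ → ℚ
δℚ i j = fromℕℚ (δ i j)

shift-A₁-1 : ∀ ℓ → shift ℓ A₁ 1 ≡ 0ℚ
shift-A₁-1 zero          = refl
shift-A₁-1 (suc zero)    = refl
shift-A₁-1 (suc (suc ℓ)) = refl

-- Every term is unchanged when ℓ and i both grow by one, which reduces the claim to ℓ = 0 or i = 0.
row-difference-tail : ∀ ℓ i →
  δℚ (1 ℕ.+ ℓ) i + fromℕℚ (1 ℕ.+ ℓ ∸ i) + δℚ (1 ℕ.+ ℓ) i + shift ℓ A₁ (2 ℕ.+ i)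
  ≡ δℚ (2 ℕ.+ ℓ) i + fromℕℚ (2 ℕ.+ ℓ ∸ i) + δℚ ℓ i + q -[1+ 0 ]
row-difference-tail zero    zero                = refl
row-difference-tail zero    (suc zero)          = refl
row-difference-tail zero    (suc (suc zero))    = refl
row-difference-tail zero    (suc (suc (suc i))) = cong (λ x → 0ℚ + x) (A₁-tail i)
row-difference-tail (suc ℓ) zero rewrite shift-A₁-1 ℓ | fromℕℚ-suc (2 ℕ.+ ℓ) =
  solve 1 (λ x → con 0ℚ :+ x :+ con 0ℚ :+ con 0ℚ := con 0ℚ :+ (con 1ℚ :+ x) :+ con 0ℚ :+ con (q -[1+ 0 ])) refl
    (fromℕℚ (2 ℕ.+ ℓ))
  where open +-*-Solver
row-difference-tail (suc ℓ) (suc i) = row-difference-tail ℓ i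

shift-A₁-0 : ∀ ℓ → shift ℓ A₁ 0 ≡ 0ℚ
shift-A₁-0 zero    = refl
shift-A₁-0 (suc ℓ) = refl

-- The second difference in ℓ and k, with all negative terms moved across.
row-difference : ∀ ℓ k →
  δℚ (3 ℕ.+ ℓ) k + fromℕℚ (row ℓ (suc k)) + δℚ (3 ℕ.+ ℓ) k + shift ℓ A₁ k
  ≡ δℚ (4 ℕ.+ ℓ) k + fromℕℚ (row ℓ k) + δℚ (2 ℕ.+ ℓ) k + C₁ k + linearTerm ℓ k
row-difference ℓ zero rewrite shift-A₁-0 ℓ | fromℕℚ-+ 2 ℓ =
  solve 1 (λ x → con 0ℚ :+ (con (fromℕℚ 2) :+ x) :+ con 0ℚ :+ con 0ℚ
    := con 0ℚ :+ con 0ℚ :+ con 0ℚ :+ con (fromℕℚ 2) :+ x) refl (fromℕℚ ℓ)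
  where open +-*-Solver
row-difference ℓ (suc zero) rewrite shift-A₁-1 ℓ = sym (+-identityʳ _)
row-difference ℓ (suc (suc i)) rewrite C₁-tail i = trans (row-difference-tail ℓ i) (sym (+-identityʳ _))

-- For ℓ = 0 the outcomes are just 1 and 3, so the counts vanish from k = 4 on and only the tail of
-- A₂ + B₂ remains.
base-difference : ∀ k → fromℕℚ (childCount 0 (suc k)) ≡ fromℕℚ (childCount 0 k) + increment 0 k
base-difference zero = refl
base-difference (suc zero) = refl
base-difference (suc (suc zero)) = refl
base-difference (suc (suc (suc zero))) = refl
base-difference (suc (suc (suc (suc i)))) = begin
  0ℚ ≡⟨ sym (A₂+B₂-tail i) ⟩
  A₂ (4 ℕ.+ i) + B₂ (4 ℕ.+ i)
    ≡⟨ solve 3 (λ a b c → a :+ b := con 0ℚ :+ (a :+ b :+ c :* con 0ℚ :+ con 0ℚ)) refl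
         (A₂ (4 ℕ.+ i)) (B₂ (4 ℕ.+ i)) (C₁ (4 ℕ.+ i)) ⟩
  0ℚ + (A₂ (4 ℕ.+ i) + B₂ (4 ℕ.+ i) + C₁ (4 ℕ.+ i) * 0ℚ + 0ℚ) ∎
  where
  open ≡-Reasoning
  open +-*-Solver

-- Raising ℓ moves the largest outcome from ℓ + 3 to ℓ + 4 and adds one row.
fromℕℚ-childCount-suc : ∀ ℓ k → fromℕℚ (childCount (suc ℓ) k) + δℚ (3 ℕ.+ ℓ) k
  ≡ fromℕℚ (childCount ℓ k) + (δℚ (4 ℕ.+ ℓ) k + fromℕℚ (row ℓ k))
fromℕℚ-childCount-suc ℓ k = begin
  fromℕℚ (childCount (suc ℓ) k) + δℚ (3 ℕ.+ ℓ) k     ≡⟨ sym (fromℕℚ-+ (childCount (suc ℓ) k) _) ⟩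
  fromℕℚ (childCount (suc ℓ) k ℕ.+ δ (3 ℕ.+ ℓ) k)    ≡⟨ cong fromℕℚ eq ⟩
  fromℕℚ (childCount ℓ k ℕ.+ (δ (4 ℕ.+ ℓ) k ℕ.+ row ℓ k))
    ≡⟨ trans (fromℕℚ-+ (childCount ℓ k) _) (cong (λ x → fromℕℚ (childCount ℓ k) + x) (fromℕℚ-+ (δ (4 ℕ.+ ℓ) k) _)) ⟩
  fromℕℚ (childCount ℓ k) + (δℚ (4 ℕ.+ ℓ) k + fromℕℚ (row ℓ k)) ∎
  where
  open ≡-Reasoning
  regroup : ∀ a b c d e → a ℕ.+ (b ℕ.+ (c ℕ.+ d)) ℕ.+ e ≡ e ℕ.+ (b ℕ.+ c) ℕ.+ (a ℕ.+ d)
  regroup = ℕ-Solver.solve-∀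
  eq : childCount (suc ℓ) k ℕ.+ δ (3 ℕ.+ ℓ) k ≡ childCount ℓ k ℕ.+ (δ (4 ℕ.+ ℓ) k ℕ.+ row ℓ k)
  eq rewrite Σ<-suc ℓ (λ m → row m k) = regroup (δ (4 ℕ.+ ℓ) k) (δ 1 k) _ (row ℓ k) (δ (3 ℕ.+ ℓ) k)

increment-suc : ∀ ℓ k → increment (suc ℓ) k + shift ℓ A₁ k ≡ increment ℓ k + (C₁ k + linearTerm ℓ k)
increment-suc ℓ k rewrite shift-A₂ ℓ k | fallingTerm-suc ℓ k | fromℕℚ-suc ℓ =
  solve 7 (λ a b c x f l s → (a :+ b :+ c :* (con 1ℚ :+ x) :+ (f :+ l)) :+ s
    := ((a :+ s) :+ b :+ c :* x :+ f) :+ (c :+ l)) refl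
    (shift (suc ℓ) A₂ k) (B₂ k) (C₁ k) (fromℕℚ ℓ) (fallingTerm ℓ k) (linearTerm ℓ k) (shift ℓ A₁ k)
  where open +-*-Solver

childCount-difference : ∀ ℓ k → fromℕℚ (childCount ℓ (suc k)) ≡ fromℕℚ (childCount ℓ k) + increment ℓ k
childCount-difference zero    k = base-difference k
childCount-difference (suc ℓ) k = combine
  (fromℕℚ (childCount (suc ℓ) (suc k))) (fromℕℚ (childCount (suc ℓ) k))
  (fromℕℚ (childCount ℓ (suc k))) (fromℕℚ (childCount ℓ k))
  -- `δℚ (2 ℕ.+ ℓ) k` and `δℚ (3 ℕ.+ ℓ) k` also stand for `δℚ (3 ℕ.+ ℓ) (suc k)` and
  -- `δℚ (4 ℕ.+ ℓ) (suc k)`, to which they are equal by computation.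
  (increment ℓ k) (increment (suc ℓ) k) (δℚ (2 ℕ.+ ℓ) k) (δℚ (3 ℕ.+ ℓ) k) (δℚ (4 ℕ.+ ℓ) k)
  (fromℕℚ (row ℓ k)) (fromℕℚ (row ℓ (suc k))) (shift ℓ A₁ k) (C₁ k) (linearTerm ℓ k)
  (childCount-difference ℓ k) (fromℕℚ-childCount-suc ℓ (suc k)) (fromℕℚ-childCount-suc ℓ k)
  (increment-suc ℓ k) (row-difference ℓ k)
  where
  open +-*-Solver
  open ≡-Reasoning
  combine : ∀ c₁′ c₁ c₀′ c₀ i₀ i₁ d₂ d₃ d₄ r r′ s c l →
    c₀′ ≡ c₀ + i₀ → c₁′ + d₂ ≡ c₀′ + (d₃ + r′) → c₁ + d₃ ≡ c₀ + (d₄ + r) →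
    i₁ + s ≡ i₀ + (c + l) → d₃ + r′ + d₃ + s ≡ d₄ + r + d₂ + c + l → c₁′ ≡ c₁ + i₁
  combine c₁′ c₁ c₀′ c₀ i₀ i₁ d₂ d₃ d₄ r r′ s c l e₀ e₁′ e₁ eᵢ e = begin
    -- Terms are added and subtracted so that each hypothesis applies to a literal subexpression.
    c₁′ ≡⟨ solve 4 (λ c₁′ d₂ d₃ s → c₁′ := (c₁′ :+ d₂) :+ (d₃ :+ s) :+ :- (d₂ :+ d₃ :+ s)) refl c₁′ d₂ d₃ s ⟩
    (c₁′ + d₂) + (d₃ + s) + - (d₂ + d₃ + s)
      ≡⟨ cong (λ x → x + (d₃ + s) + - (d₂ + d₃ + s)) (trans e₁′ (cong (_+ (d₃ + r′)) e₀)) ⟩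
    c₀ + i₀ + (d₃ + r′) + (d₃ + s) + - (d₂ + d₃ + s)
      ≡⟨ solve 6 (λ c₀ i₀ d₃ r′ s d₂ → c₀ :+ i₀ :+ (d₃ :+ r′) :+ (d₃ :+ s) :+ :- (d₂ :+ d₃ :+ s)
           := c₀ :+ i₀ :+ (d₃ :+ r′ :+ d₃ :+ s) :+ :- (d₂ :+ d₃ :+ s)) refl c₀ i₀ d₃ r′ s d₂ ⟩
    c₀ + i₀ + (d₃ + r′ + d₃ + s) + - (d₂ + d₃ + s)
      ≡⟨ cong (λ x → c₀ + i₀ + x + - (d₂ + d₃ + s)) e ⟩
    c₀ + i₀ + (d₄ + r + d₂ + c + l) + - (d₂ + d₃ + s)
      ≡⟨ solve 9 (λ c₀ i₀ d₄ r d₂ c l d₃ s → c₀ :+ i₀ :+ (d₄ :+ r :+ d₂ :+ c :+ l) :+ :- (d₂ :+ d₃ :+ s)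
           := (c₀ :+ (d₄ :+ r)) :+ (i₀ :+ (c :+ l)) :+ :- (d₃ :+ s)) refl c₀ i₀ d₄ r d₂ c l d₃ s ⟩
    (c₀ + (d₄ + r)) + (i₀ + (c + l)) + - (d₃ + s)
      ≡⟨ cong₂ (λ x y → x + y + - (d₃ + s)) (sym e₁) (sym eᵢ) ⟩
    (c₁ + d₃) + (i₁ + s) + - (d₃ + s)
      ≡⟨ solve 4 (λ c₁ d₃ i₁ s → (c₁ :+ d₃) :+ (i₁ :+ s) :+ :- (d₃ :+ s) := c₁ :+ i₁) refl c₁ d₃ i₁ s ⟩
    c₁ + i₁ ∎

-- Formal power series

sumTo-cong : ∀ k {f g : ℕ → ℚ} → (∀ {j} → j ≤ k → f j ≡ g j) → sumTo k f ≡ sumTo k g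
sumTo-cong zero    eq = eq z≤n
sumTo-cong (suc k) eq = cong₂ _+_ (sumTo-cong k (λ j≤k → eq (ℕ.m≤n⇒m≤1+n j≤k))) (eq ℕ.≤-refl)

sumTo-0 : ∀ k → sumTo k (λ _ → 0ℚ) ≡ 0ℚ
sumTo-0 zero    = refl
sumTo-0 (suc k) = trans (+-identityʳ _) (sumTo-0 k)

sumTo-zero : ∀ k {f : ℕ → ℚ} → (∀ {j} → j ≤ k → f j ≡ 0ℚ) → sumTo k f ≡ 0ℚ
sumTo-zero k eq = trans (sumTo-cong k eq) (sumTo-0 k)

sumTo-head : ∀ k (f : ℕ → ℚ) → sumTo (suc k) f ≡ f 0 + sumTo k (f ∘ suc)
sumTo-head zero    f = refl
sumTo-head (suc k) f = trans (cong (λ s → s + f (suc (suc k))) (sumTo-head k f)) (+-assoc (f 0) _ _)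

sumTo-first : ∀ k (f : ℕ → ℚ) → (∀ j → f (suc j) ≡ 0ℚ) → sumTo k f ≡ f 0
sumTo-first zero    f eq = refl
sumTo-first (suc k) f eq = trans (cong₂ _+_ (sumTo-first k f eq) (eq k)) (+-identityʳ _)

sumTo-reverse : ∀ k (f : ℕ → ℚ) → sumTo k (λ j → f (k ∸ j)) ≡ sumTo k f
sumTo-reverse zero    f = refl
sumTo-reverse (suc k) f = trans (sumTo-head k (λ j → f (suc k ∸ j)))
  (trans (cong (λ s → f (suc k) + s) (sumTo-reverse k f)) (+-comm (f (suc k)) _))

interchange : ∀ a b c d → (a + b) + (c + d) ≡ (a + c) + (b + d)
interchange = solve 4 (λ a b c d → (a :+ b) :+ (c :+ d) := (a :+ c) :+ (b :+ d)) refl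
  where open +-*-Solver

sumTo-+ : ∀ k (f g : ℕ → ℚ) → sumTo k (λ j → f j + g j) ≡ sumTo k f + sumTo k g
sumTo-+ zero    f g = refl
sumTo-+ (suc k) f g = trans (cong (λ s → s + (f (suc k) + g (suc k))) (sumTo-+ k f g))
  (interchange (sumTo k f) (sumTo k g) (f (suc k)) (g (suc k)))

-- A factor in u alone leaves the power of x untouched.
⊛-row₀ : ∀ F G → (∀ i k → F (suc i) k ≡ 0ℚ) → ∀ n k → (F ⊛ G) n k ≡ sumTo k (λ j → F 0 j * G n (k ∸ j))
⊛-row₀ F G F≡0 n k = sumTo-first n _ (λ i → sumTo-zero k (λ {j} _ →
  trans (cong (λ x → x * G (n ∸ suc i) (k ∸ j)) (F≡0 i j)) (*-zeroˡ (G (n ∸ suc i) (k ∸ j)))))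

module _ (F G : Series) (F₀ : ∀ k → F 0 k ≡ 0ℚ) where

  private
    row₀ : ∀ n k → sumTo k (λ j → F 0 j * G n (k ∸ j)) ≡ 0ℚ
    row₀ n k = sumTo-zero k (λ {j} _ → trans (cong (λ x → x * G n (k ∸ j)) (F₀ j)) (*-zeroˡ (G n (k ∸ j))))

  ⊛-row₁-0 : ∀ k → (F ⊛ G) 0 k ≡ 0ℚ
  ⊛-row₁-0 k = row₀ 0 k

  ⊛-row₁-suc : (∀ i k → F (suc (suc i)) k ≡ 0ℚ) →
    ∀ n k → (F ⊛ G) (suc n) k ≡ sumTo k (λ j → F 1 j * G n (k ∸ j))
  ⊛-row₁-suc F₂ n k = trans (sumTo-head n _) (trans (cong₂ _+_ (row₀ (suc n) k) (sumTo-first n _ higher)) (+-identityˡ _))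
    where
    higher : ∀ i → sumTo k (λ j → F (suc (suc i)) j * G (n ∸ suc i) (k ∸ j)) ≡ 0ℚ
    higher i = sumTo-zero k (λ {j} _ →
      trans (cong (λ x → x * G (n ∸ suc i) (k ∸ j)) (F₂ i j)) (*-zeroˡ (G (n ∸ suc i) (k ∸ j))))

polyU⊛inv1-u-suc : ∀ cs i k → (polyU cs ⊛ inv1-u) (suc i) k ≡ 0ℚ
polyU⊛inv1-u-suc cs i k = trans (⊛-row₀ (polyU cs) inv1-u (λ _ _ → refl) (suc i) k)
  (sumTo-zero k (λ {j} _ → *-zeroʳ (polyU cs 0 j)))

polyU⊛inv1-u²-suc : ∀ cs i k → (polyU cs ⊛ inv1-u ⊛ inv1-u) (suc i) k ≡ 0ℚ
polyU⊛inv1-u²-suc cs i k = trans (⊛-row₀ (polyU cs ⊛ inv1-u) inv1-u (polyU⊛inv1-u-suc cs) (suc i) k)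
  (sumTo-zero k (λ {j} _ → *-zeroʳ ((polyU cs ⊛ inv1-u) 0 j)))

-- Multiplication by the outer factor x u / (1 - u).

X⊛U : Series
X⊛U = X ⊛ U

X⊛U-0 : ∀ k → X⊛U 0 k ≡ 0ℚ
X⊛U-0 = ⊛-row₁-0 X U (λ _ → refl)

X⊛U-suc : ∀ n k → X⊛U (suc n) k ≡ U n k
X⊛U-suc n k = trans (⊛-row₁-suc X U (λ _ → refl) (λ _ _ → refl) n k)
  (trans (sumTo-first k _ (λ j → *-zeroˡ (U n (k ∸ suc j)))) (*-identityˡ (U n k)))

K : Series
K = X ⊛ U ⊛ inv1-u

K-0 : ∀ k → K 0 k ≡ 0ℚ
K-0 = ⊛-row₁-0 X⊛U inv1-u X⊛U-0

K-suc : ∀ n k → K (suc n) k ≡ sumTo k (λ j → U 0 j * inv1-u n (k ∸ j))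
K-suc n k = trans (⊛-row₁-suc X⊛U inv1-u X⊛U-0 (λ i k → X⊛U-suc (suc i) k) n k)
  (sumTo-cong k (λ {j} _ → cong (λ x → x * inv1-u n (k ∸ j)) (X⊛U-suc 0 j)))

K-2+ : ∀ n k → K (suc (suc n)) k ≡ 0ℚ
K-2+ n k = trans (K-suc (suc n) k) (sumTo-zero k (λ {j} _ → *-zeroʳ (U 0 j)))

K-1-suc : ∀ k → K 1 (suc k) ≡ 1ℚ
K-1-suc k = trans (K-suc 0 (suc k)) (trans (sumTo-head k (λ j → U 0 j * 1ℚ))
  (trans (+-identityˡ _) (sumTo-first k (λ j → U 0 (suc j) * 1ℚ) (λ _ → refl))))

K⊛-0 : ∀ G k → (K ⊛ G) 0 k ≡ 0ℚ
K⊛-0 G = ⊛-row₁-0 K G K-0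

K⊛-suc-0 : ∀ G n → (K ⊛ G) (suc n) 0 ≡ 0ℚ
K⊛-suc-0 G n = trans (⊛-row₁-suc K G K-0 K-2+ n 0) (trans (cong (λ x → x * G n 0) (K-suc 0 0)) (*-zeroˡ (G n 0)))

-- The factor 1 / (1 - u) takes partial sums in k, and x u raises both degrees by one.
K⊛-suc-suc : ∀ G n k → (K ⊛ G) (suc n) (suc k) ≡ sumTo k (G n)
K⊛-suc-suc G n k = trans (⊛-row₁-suc K G K-0 K-2+ n (suc k))
  (trans (sumTo-head k (λ j → K 1 j * G n (suc k ∸ j)))
  (trans (cong₂ _+_ (trans (cong (λ x → x * G n (suc k)) (K-suc 0 0)) (*-zeroˡ (G n (suc k))))
                    (sumTo-cong k (λ {j} _ → trans (cong (λ x → x * G n (k ∸ j)) (K-1-suc j)) (*-identityˡ (G n (k ∸ j))))))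
  (trans (+-identityˡ _) (sumTo-reverse k (G n)))))

-- Sums over lists of lif values.

ΣL : (ℕ → ℚ) → List ℕ → ℚ
ΣL f []       = 0ℚ
ΣL f (ℓ ∷ ls) = f ℓ + ΣL f ls

ΣL-cong : ∀ {f g : ℕ → ℚ} ls → (∀ ℓ → f ℓ ≡ g ℓ) → ΣL f ls ≡ ΣL g ls
ΣL-cong []       eq = refl
ΣL-cong (ℓ ∷ ls) eq = cong₂ _+_ (eq ℓ) (ΣL-cong ls eq)

ΣL-zero : ∀ ls → ΣL (λ _ → 0ℚ) ls ≡ 0ℚ
ΣL-zero []       = refl
ΣL-zero (ℓ ∷ ls) = trans (+-identityˡ _) (ΣL-zero ls)

ΣL-+ : ∀ f g ls → ΣL (λ ℓ → f ℓ + g ℓ) ls ≡ ΣL f ls + ΣL g ls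
ΣL-+ f g []       = refl
ΣL-+ f g (ℓ ∷ ls) = trans (cong (λ s → f ℓ + g ℓ + s) (ΣL-+ f g ls)) (interchange (f ℓ) (g ℓ) (ΣL f ls) (ΣL g ls))

ΣL-* : ∀ c f ls → ΣL (λ ℓ → c * f ℓ) ls ≡ c * ΣL f ls
ΣL-* c f []       = sym (*-zeroʳ c)
ΣL-* c f (ℓ ∷ ls) = trans (cong (λ s → c * f ℓ + s) (ΣL-* c f ls)) (sym (*-distribˡ-+ c (f ℓ) _))

sumTo-ΣL : ∀ k (f : ℕ → ℕ → ℚ) ls → sumTo k (λ j → ΣL (f j) ls) ≡ ΣL (λ ℓ → sumTo k (λ j → f j ℓ)) ls
sumTo-ΣL k f []       = sumTo-0 k
sumTo-ΣL k f (ℓ ∷ ls) = trans (sumTo-+ k (λ j → f j ℓ) (λ j → ΣL (f j) ls))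
  (cong (λ s → sumTo k (λ j → f j ℓ) + s) (sumTo-ΣL k f ls))

fromℕℚ-sum : ∀ (f : ℕ → ℕ) ls → fromℕℚ (sum (map f ls)) ≡ ΣL (λ ℓ → fromℕℚ (f ℓ)) ls
fromℕℚ-sum f []       = refl
fromℕℚ-sum f (ℓ ∷ ls) = trans (fromℕℚ-+ (f ℓ) _) (cong (λ s → fromℕℚ (f ℓ) + s) (fromℕℚ-sum f ls))

sumTo-δ : ∀ {M ℓ} (w : ℕ → ℕ) → ℓ ≤ M → sumTo M (λ k → fromℕℚ (w k ℕ.* δ ℓ k)) ≡ fromℕℚ (w ℓ)
sumTo-δ {M} {zero} w z≤n = trans
  (sumTo-first M _ (λ j → cong fromℕℚ (ℕ.*-zeroʳ (w (suc j)))))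
  (cong fromℕℚ (ℕ.*-identityʳ (w 0)))
sumTo-δ {suc M} {suc ℓ} w (s≤s ℓ≤M) = trans (sumTo-head M _)
  (trans (cong₂ _+_ (cong fromℕℚ (ℕ.*-zeroʳ (w 0))) (sumTo-δ (w ∘ suc) ℓ≤M)) (+-identityˡ _))

sumTo-moment : ∀ {M} (w : ℕ → ℕ) {ls} → All (_≤ M) ls →
  sumTo M (λ k → fromℕℚ (w k ℕ.* sum (map (λ ℓ → δ ℓ k) ls))) ≡ ΣL (λ ℓ → fromℕℚ (w ℓ)) ls
sumTo-moment {M} w []       = sumTo-zero M (λ {k} _ → cong fromℕℚ (ℕ.*-zeroʳ (w k)))
sumTo-moment {M} w {ℓ ∷ ls} (p ∷ ps) = begin
  sumTo M (λ k → fromℕℚ (w k ℕ.* (δ ℓ k ℕ.+ s k)))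
    ≡⟨ sumTo-cong M (λ {k} _ → trans (cong fromℕℚ (ℕ.*-distribˡ-+ (w k) (δ ℓ k) (s k))) (fromℕℚ-+ (w k ℕ.* δ ℓ k) _)) ⟩
  sumTo M (λ k → fromℕℚ (w k ℕ.* δ ℓ k) + fromℕℚ (w k ℕ.* s k))
    ≡⟨ sumTo-+ M _ _ ⟩
  sumTo M (λ k → fromℕℚ (w k ℕ.* δ ℓ k)) + sumTo M (λ k → fromℕℚ (w k ℕ.* s k))
    ≡⟨ cong₂ _+_ (sumTo-δ w p) (sumTo-moment w ps) ⟩
  fromℕℚ (w ℓ) + ΣL (λ ℓ → fromℕℚ (w ℓ)) ls ∎
  where
  open ≡-Reasoning
  s : ℕ → ℕ
  s k = sum (map (λ ℓ → δ ℓ k) ls)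

-- The weights 1, k and k (k - 1) give H and its first two u-derivatives at u = 1. The range
-- suffices because no lif exceeds 3n.
moment : ∀ n (w : ℕ → ℕ) → sumTo (3 ℕ.* n) (λ k → fromℕℚ (w k ℕ.* h n k)) ≡ ΣL (λ ℓ → fromℕℚ (w ℓ)) (lifs n)
moment n w = trans
  (sumTo-cong (3 ℕ.* n) (λ {k} _ → cong (λ m → fromℕℚ (w k ℕ.* m)) (h-lifs n k)))
  (sumTo-moment w (lifs-≤ n))

H₁-lifs : ∀ n → H₁ n 0 ≡ ΣL (λ _ → 1ℚ) (lifs n)
H₁-lifs n = trans (sumTo-cong (3 ℕ.* n) (λ {k} _ → cong fromℕℚ (sym (ℕ.*-identityˡ (h n k))))) (moment n (λ _ → 1))

H-lifs : ∀ n k → H n k ≡ ΣL (λ ℓ → δℚ ℓ k) (lifs n)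
H-lifs n k = trans (cong fromℕℚ (h-lifs n k)) (fromℕℚ-sum (λ ℓ → δ ℓ k) (lifs n))

-- Applies to the specialisations at u = 1, which are constant in u.
convolution-column₀ : ∀ (a F : ℕ → ℚ) → (∀ k → F (suc k) ≡ 0ℚ) → ∀ k → sumTo k (λ j → a j * F (k ∸ j)) ≡ a k * F 0
convolution-column₀ a F F≡0 k = trans (sym (sumTo-reverse k _))
  (trans (sumTo-cong k (λ {j} j≤k → cong (λ i → a (k ∸ j) * F i) (ℕ.m∸[m∸n]≡n j≤k)))
  (sumTo-first k (λ j → a (k ∸ j) * F j) (λ j → trans (cong (λ x → a (k ∸ suc j) * x) (F≡0 j)) (*-zeroʳ (a (k ∸ suc j))))))

convolution-δ : ∀ ℓ (a : ℕ → ℚ) k → sumTo k (λ j → a j * δℚ ℓ (k ∸ j)) ≡ shift ℓ a k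
convolution-δ zero    a k       = trans (convolution-column₀ a (δℚ 0) (λ _ → refl) k) (*-identityʳ (a k))
convolution-δ (suc ℓ) a zero    = *-zeroʳ (a 0)
convolution-δ (suc ℓ) a (suc k) = trans
  (cong₂ _+_
    (trans (sumTo-cong k (λ {j} j≤k → cong (λ i → a j * δℚ (suc ℓ) i) (ℕ.+-∸-assoc 1 j≤k))) (convolution-δ ℓ a k))
    (trans (cong (λ i → a (suc k) * δℚ (suc ℓ) i) (ℕ.n∸n≡0 k)) (*-zeroʳ (a (suc k)))))
  (+-identityʳ _)

-- The bracket of the functional equation.

bracket : Series
bracket = Apoly ⊛ inv1-u ⊛ inv1-u ⊛ H
        ⊕ Bpoly ⊛ inv1-u ⊛ inv1-u ⊛ H₁
        ⊕ Cpoly ⊛ inv1-u ⊛ Hu₁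
        ⊕ scal ½ Huu₁

bracket-lifs : ∀ n k → bracket n k ≡ ΣL (λ ℓ → increment ℓ k) (lifs n)
bracket-lifs n k = begin
  bracket n k
    ≡⟨ cong₂ _+_ (cong₂ _+_ (cong₂ _+_ termA termB) termC) (termD k) ⟩
  ΣL (λ ℓ → shift ℓ A₂ k) ls + ΣL (λ _ → B₂ k) ls + ΣL (λ ℓ → C₁ k * fromℕℚ ℓ) ls + ΣL (λ ℓ → fallingTerm ℓ k) ls
    ≡⟨ cong (λ s → s + ΣL (λ ℓ → C₁ k * fromℕℚ ℓ) ls + ΣL (λ ℓ → fallingTerm ℓ k) ls)
         (sym (ΣL-+ (λ ℓ → shift ℓ A₂ k) (λ _ → B₂ k) ls)) ⟩
  ΣL (λ ℓ → shift ℓ A₂ k + B₂ k) ls + ΣL (λ ℓ → C₁ k * fromℕℚ ℓ) ls + ΣL (λ ℓ → fallingTerm ℓ k) ls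
    ≡⟨ cong (λ s → s + ΣL (λ ℓ → fallingTerm ℓ k) ls) (sym (ΣL-+ (λ ℓ → shift ℓ A₂ k + B₂ k) (λ ℓ → C₁ k * fromℕℚ ℓ) ls)) ⟩
  ΣL (λ ℓ → shift ℓ A₂ k + B₂ k + C₁ k * fromℕℚ ℓ) ls + ΣL (λ ℓ → fallingTerm ℓ k) ls
    ≡⟨ sym (ΣL-+ (λ ℓ → shift ℓ A₂ k + B₂ k + C₁ k * fromℕℚ ℓ) (λ ℓ → fallingTerm ℓ k) ls) ⟩
  ΣL (λ ℓ → increment ℓ k) ls ∎
  where
  open ≡-Reasoning
  ls = lifs n

  termA : (Apoly ⊛ inv1-u ⊛ inv1-u ⊛ H) n k ≡ ΣL (λ ℓ → shift ℓ A₂ k) ls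
  termA = begin
    (Apoly ⊛ inv1-u ⊛ inv1-u ⊛ H) n k
      ≡⟨ ⊛-row₀ (Apoly ⊛ inv1-u ⊛ inv1-u) H (polyU⊛inv1-u²-suc _) n k ⟩
    sumTo k (λ j → A₂ j * H n (k ∸ j))
      ≡⟨ sumTo-cong k (λ {j} _ → trans (cong (λ x → A₂ j * x) (H-lifs n (k ∸ j))) (sym (ΣL-* (A₂ j) (λ ℓ → δℚ ℓ (k ∸ j)) ls))) ⟩
    sumTo k (λ j → ΣL (λ ℓ → A₂ j * δℚ ℓ (k ∸ j)) ls)
      ≡⟨ sumTo-ΣL k (λ j ℓ → A₂ j * δℚ ℓ (k ∸ j)) ls ⟩
    ΣL (λ ℓ → sumTo k (λ j → A₂ j * δℚ ℓ (k ∸ j))) ls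
      ≡⟨ ΣL-cong ls (λ ℓ → convolution-δ ℓ A₂ k) ⟩
    ΣL (λ ℓ → shift ℓ A₂ k) ls ∎

  termB : (Bpoly ⊛ inv1-u ⊛ inv1-u ⊛ H₁) n k ≡ ΣL (λ _ → B₂ k) ls
  termB = begin
    (Bpoly ⊛ inv1-u ⊛ inv1-u ⊛ H₁) n k
      ≡⟨ ⊛-row₀ (Bpoly ⊛ inv1-u ⊛ inv1-u) H₁ (polyU⊛inv1-u²-suc _) n k ⟩
    sumTo k (λ j → B₂ j * H₁ n (k ∸ j))
      ≡⟨ convolution-column₀ B₂ (H₁ n) (λ _ → refl) k ⟩
    B₂ k * H₁ n 0
      ≡⟨ cong (λ x → B₂ k * x) (H₁-lifs n) ⟩
    B₂ k * ΣL (λ _ → 1ℚ) ls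
      ≡⟨ sym (ΣL-* (B₂ k) (λ _ → 1ℚ) ls) ⟩
    ΣL (λ _ → B₂ k * 1ℚ) ls
      ≡⟨ ΣL-cong ls (λ _ → *-identityʳ (B₂ k)) ⟩
    ΣL (λ _ → B₂ k) ls ∎

  termC : (Cpoly ⊛ inv1-u ⊛ Hu₁) n k ≡ ΣL (λ ℓ → C₁ k * fromℕℚ ℓ) ls
  termC = begin
    (Cpoly ⊛ inv1-u ⊛ Hu₁) n k
      ≡⟨ ⊛-row₀ (Cpoly ⊛ inv1-u) Hu₁ (polyU⊛inv1-u-suc _) n k ⟩
    sumTo k (λ j → C₁ j * Hu₁ n (k ∸ j))
      ≡⟨ convolution-column₀ C₁ (Hu₁ n) (λ _ → refl) k ⟩
    C₁ k * Hu₁ n 0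
      ≡⟨ cong (λ x → C₁ k * x) (moment n id) ⟩
    C₁ k * ΣL fromℕℚ ls
      ≡⟨ sym (ΣL-* (C₁ k) fromℕℚ ls) ⟩
    ΣL (λ ℓ → C₁ k * fromℕℚ ℓ) ls ∎

  termD : ∀ k → scal ½ Huu₁ n k ≡ ΣL (λ ℓ → fallingTerm ℓ k) ls
  termD zero    = trans (cong (λ x → ½ * x) (moment n (λ k → k ℕ.* (k ∸ 1)))) (sym (ΣL-* ½ (λ ℓ → fromℕℚ (ℓ ℕ.* (ℓ ∸ 1))) ls))
  termD (suc k) = sym (ΣL-zero ls)

-- Telescoping in the power of u.

H-suc : ∀ n k → H (suc n) k ≡ ΣL (λ ℓ → fromℕℚ (childCount ℓ k)) (lifs n)
H-suc n k = trans (cong fromℕℚ (h-childCount n k)) (fromℕℚ-sum (λ ℓ → childCount ℓ k) (lifs n))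

-- Every outcome of appending a shrub has positive lif; this starts the telescoping sum.
H-suc-0 : ∀ n → H (suc n) 0 ≡ 0ℚ
H-suc-0 n = trans (H-suc n 0) (trans (ΣL-cong (lifs n) (λ ℓ → cong fromℕℚ (Σ<-zero ℓ))) (ΣL-zero (lifs n)))

H-suc-suc : ∀ n k → H (suc n) (suc k) ≡ H (suc n) k + bracket n k
H-suc-suc n k = begin
  H (suc n) (suc k)
    ≡⟨ H-suc n (suc k) ⟩
  ΣL (λ ℓ → fromℕℚ (childCount ℓ (suc k))) (lifs n)
    ≡⟨ ΣL-cong (lifs n) (λ ℓ → childCount-difference ℓ k) ⟩
  ΣL (λ ℓ → fromℕℚ (childCount ℓ k) + increment ℓ k) (lifs n)
    ≡⟨ ΣL-+ (λ ℓ → fromℕℚ (childCount ℓ k)) (λ ℓ → increment ℓ k) (lifs n) ⟩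
  ΣL (λ ℓ → fromℕℚ (childCount ℓ k)) (lifs n) + ΣL (λ ℓ → increment ℓ k) (lifs n)
    ≡⟨ sym (cong₂ _+_ (H-suc n k) (bracket-lifs n k)) ⟩
  H (suc n) k + bracket n k ∎
  where open ≡-Reasoning

H-sumTo : ∀ n k → H (suc n) (suc k) ≡ sumTo k (bracket n)
H-sumTo n zero    = trans (H-suc-suc n 0) (trans (cong (λ x → x + bracket n 0) (H-suc-0 n)) (+-identityˡ _))
H-sumTo n (suc k) = trans (H-suc-suc n (suc k)) (cong (λ x → x + bracket n (suc k)) (H-sumTo n k))

theorem16 : (n k : ℕ) → H n k ≡ RHS n k
theorem16 zero    zero    = sym (cong (λ x → 1ℚ + x) (K⊛-0 bracket 0))
theorem16 zero    (suc k) = sym (cong (λ x → 0ℚ + x) (K⊛-0 bracket (suc k)))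
theorem16 (suc n) zero    = trans (H-suc-0 n) (sym (cong (λ x → 0ℚ + x) (K⊛-suc-0 bracket n)))
theorem16 (suc n) (suc k) = trans (H-sumTo n k) (sym (trans (+-identityˡ _) (K⊛-suc-suc bracket n k)))
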